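{- The membership problem in $\mathbf{L}_{\min}$, that is, the problem of determining whether a given signed formula is in $\mathbf{L}_{\min}$, is decidable.
   Context: Syntax. $\mathbf{At}=\{p_i : i\in\mathbb{N}\}$ is a countable set of atoms (enumerated without repetition). The set $\mathbf{Fo}$ of formulas is generated by $A ::= p \mid (A\rightharpoonup A)\mid (A\leftharpoondown A)\mid \top\mid\bot\mid (A\vee A)\mid (A\wedge A)\mid \lozenge A\mid\square A\mid⧫ A\mid\blacksquare A$, with $p\in\mathbf{At}$. Unary connectives bind tightest. A signed formula is a pair $(\alpha,A)$ with $\alpha\in\{+,-\}$ and $A\in\mathbf{Fo}$; $\mathbf{SFo}$ is the set of signed formulas. A substitution is a function $\sigma:\mathbf{Fo}\to\mathbf{Fo}$ preserving all connectives. Intuitionistic modal logics. An intuitionistic modal logic (IML) is a set $\mathbf{L}\subseteq\mathbf{SFo}$ closed under uniform substitution (if $(\alpha,A)\in\mathbf{L}$ then $(\alpha,\sigma(A))\in\mathbf{L}$ for every substitution $\sigma$), closed under the rules below (for all formulas $A,B,C$), and containing the axioms below ($p,q,r$ distinct atoms). Rules (premises $\Rightarrow$ conclusion): (R1$^+$) $(+,A),(+,A\rightharpoonup B)\Rightarrow(+,B)$; (R1$^-$) $(-,A),(-,A\leftharpoondown B)\Rightarrow(-,B)$; (R2$^+$) $(-,A\leftharpoondown B)\Rightarrow(+,B\rightharpoonup A)$; (R2$^-$) $(+,A\rightharpoonup B)\Rightarrow(-,B\leftharpoondown A)$; (R3$^+$) $(+,A\rightharpoonup B)\Rightarrow(+,\lozenge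 A\rightharpoonup\lozenge B)$; (R3$^-$) $(-,A\leftharpoondown B)\Rightarrow(-,\square A\leftharpoondown\square B)$; (R4$^+$) $(+,A)\Rightarrow(+,\square A)$; (R4$^-$) $(-,A)\Rightarrow(-,\lozenge A)$; (R5$^+$) $(+,A\rightharpoonup B)\Rightarrow(+,⧫ A\rightharpoonup⧫ B)$; (R5$^-$) $(-,A\leftharpoondown B)\Rightarrow(-,\blacksquare A\leftharpoondown\blacksquare B)$; (R6$^+$) $(+,A)\Rightarrow(+,\blacksquare A)$; (R6$^-$) $(-,A)\Rightarrow(-,⧫ A)$; (R7$^+$) $(+,A\vee B)\Rightarrow(+,(\blacksquare A\rightharpoonup⧫ B)\rightharpoonup⧫ B)$; (R7$^-$) $(-,A\wedge B)\Rightarrow(-,(⧫ A\leftharpoondown\blacksquare B)\leftharpoondown\blacksquare B)$; (R8$^+$) $(+,\lozenge A\rightharpoonup(B\vee\square C))\Rightarrow(+,\lozenge A\rightharpoonup(B\vee\lozenge(A\wedge C)))$; (R8$^-$) $(-,\square A\leftharpoondown(B\wedge\lozenge C))\Rightarrow(-,\square A\leftharpoondown(B\wedge\square(A\vee C)))$. Positive axioms (each with sign $+$): (1) $(p\rightharpoonup(q\rightharpoonup r))\rightharpoonup((p\rightharpoonup q)\rightharpoonup(p\rightharpoonup r))$; (2) $p\rightharpoonup(q\rightharpoonup p)$; (3) $p\rightharpoonup(q\rightharpoonup(p\wedge q))$, $(p\wedge q)\rightharpoonup p$, $(p\wedge q)\rightharpoonup q$; (4) $(p\rightharpoonup r)\rightharpoonup((q\rightharpoonup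 r)\rightharpoonup((p\vee q)\rightharpoonup r))$; (5) $\top$; (6) $((p\rightharpoonup q)\wedge r)\rightharpoonup((p\leftharpoondown r)\vee q)$; (7) $\lozenge\bot\rightharpoonup\bot$; (8) $\square(p\rightharpoonup q)\rightharpoonup(\square p\rightharpoonup\square q)$; (9) $\square p\rightharpoonup\blacksquare p$; (10) $\square(p\rightharpoonup q)\rightharpoonup(⧫ p\rightharpoonup⧫ q)$; (11) $⧫(p\vee q)\rightharpoonup((\lozenge p\rightharpoonup⧫ q)\rightharpoonup⧫ q)$; (12) $\square p\rightharpoonup((\blacksquare(q\leftharpoondown p)\rightharpoonup⧫ q)\rightharpoonup⧫ q)$. Negative axioms (each with sign $-$): (1) $(p\leftharpoondown(q\leftharpoondown r))\leftharpoondown((p\leftharpoondown q)\leftharpoondown(p\leftharpoondown r))$; (2) $p\leftharpoondown(q\leftharpoondown p)$; (3) $p\leftharpoondown(q\leftharpoondown(p\vee q))$, $(p\vee q)\leftharpoondown p$, $(p\vee q)\leftharpoondown q$; (4) $(p\leftharpoondown r)\leftharpoondown((q\leftharpoondown r)\leftharpoondown((p\wedge q)\leftharpoondown r))$; (5) $\bot$; (6) $((p\leftharpoondown q)\vee r)\leftharpoondown((p\rightharpoonup r)\wedge q)$; (7) $\square\top\leftharpoondown\top$; (8) $\lozenge(p\leftharpoondown q)\leftharpoondown(\lozenge p\leftharpoondown\lozenge q)$; (9) $\lozenge p\leftharpoondown⧫ p$; (10) $\lozenge(p\leftharpoondown q)\leftharpoondown(\blacksquare p\leftharpoondown\blacksquare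 q)$; (11) $\blacksquare(p\wedge q)\leftharpoondown((\square p\leftharpoondown\blacksquare q)\leftharpoondown\blacksquare q)$; (12) $\lozenge p\leftharpoondown((⧫(q\rightharpoonup p)\leftharpoondown\blacksquare q)\leftharpoondown\blacksquare q)$. Intersections of families of IMLs are IMLs; $\mathbf{L}_{\min}$ denotes the least IML. -}

module Defs where

open import Data.List.Base using (List; []; _∷_)
open import Data.List.Relation.Unary.All using (All; []; _∷_)
open import Data.Nat.Base using (ℕ)
open import Data.Product.Base using (_×_; _,_)
open import Level using (Level; 0ℓ)
open import Relation.Binary.PropositionalEquality.Core using (_≡_; _≢_)
open import Relation.Unary using (Pred; _∈_; _⊆_)

At : Set
At = ℕ

infix 7 ◇_ □_ ⧫_ ■_
infix 6 _⇀_ _↽_ _∨_ _∧_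

data Fo : Set where
  at              : At → Fo
  _⇀_ _↽_ _∨_ _∧_ : Fo → Fo → Fo
  ⊤ ⊥             : Fo
  ◇_ □_ ⧫_ ■_     : Fo → Fo

data Sign : Set where
  + - : Sign

SFo : Set
SFo = Sign × Fo

record IsSubstitution (σ : Fo → Fo) : Set where
  field
    ⇀-homo : ∀ A B → σ (A ⇀ B) ≡ (σ A ⇀ σ B)
    ↽-homo : ∀ A B → σ (A ↽ B) ≡ (σ A ↽ σ B)
    ⊤-homo : σ ⊤ ≡ ⊤
    ⊥-homo : σ ⊥ ≡ ⊥
    ∨-homo : ∀ A B → σ (A ∨ B) ≡ (σ A ∨ σ B)
    ∧-homo : ∀ A B → σ (A ∧ B) ≡ (σ A ∧ σ B)
    ◇-homo : ∀ A → σ (◇ A) ≡ ◇ (σ A)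
    □-homo : ∀ A → σ (□ A) ≡ □ (σ A)
    ⧫-homo : ∀ A → σ (⧫ A) ≡ ⧫ (σ A)
    ■-homo : ∀ A → σ (■ A) ≡ ■ (σ A)

private
  variable
    ℓ     : Level
    A B C : Fo
    s     : SFo
    Γ     : List SFo

-- Rule Γ s: an instance of an inference rule with premises Γ and conclusion s.
-- B ↽ A is dual to B ⇀ A under the exchange of signs, so the subtrahend is
-- the left argument: A ↽ B reads "B without A".
data Rule : List SFo → SFo → Set where
  R1⁺ : Rule ((+ , A) ∷ (+ , A ⇀ B) ∷ []) (+ , B)
  R1⁻ : Rule ((- , A) ∷ (- , A ↽ B) ∷ []) (- , B)
  R2⁺ : Rule ((- , A ↽ B) ∷ []) (+ , B ⇀ A)
  R2⁻ : Rule ((+ , A ⇀ B) ∷ []) (- , B ↽ A)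
  R3⁺ : Rule ((+ , A ⇀ B) ∷ []) (+ , ◇ A ⇀ ◇ B)
  R3⁻ : Rule ((- , A ↽ B) ∷ []) (- , □ A ↽ □ B)
  R4⁺ : Rule ((+ , A) ∷ []) (+ , □ A)
  R4⁻ : Rule ((- , A) ∷ []) (- , ◇ A)
  R5⁺ : Rule ((+ , A ⇀ B) ∷ []) (+ , ⧫ A ⇀ ⧫ B)
  R5⁻ : Rule ((- , A ↽ B) ∷ []) (- , ■ A ↽ ■ B)
  R6⁺ : Rule ((+ , A) ∷ []) (+ , ■ A)
  R6⁻ : Rule ((- , A) ∷ []) (- , ⧫ A)
  R7⁺ : Rule ((+ , A ∨ B) ∷ []) (+ , (■ A ⇀ ⧫ B) ⇀ ⧫ B)
  R7⁻ : Rule ((- , A ∧ B) ∷ []) (- , (⧫ A ↽ ■ B) ↽ ■ B)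
  R8⁺ : Rule ((+ , ◇ A ⇀ (B ∨ □ C)) ∷ []) (+ , ◇ A ⇀ (B ∨ ◇ (A ∧ C)))
  R8⁻ : Rule ((- , □ A ↽ (B ∧ ◇ C)) ∷ []) (- , □ A ↽ (B ∧ □ (A ∨ C)))

data Axiom (p q r : Fo) : SFo → Set where
  A1⁺  : Axiom p q r (+ , (p ⇀ (q ⇀ r)) ⇀ ((p ⇀ q) ⇀ (p ⇀ r)))
  A2⁺  : Axiom p q r (+ , p ⇀ (q ⇀ p))
  A3a⁺ : Axiom p q r (+ , p ⇀ (q ⇀ (p ∧ q)))
  A3b⁺ : Axiom p q r (+ , (p ∧ q) ⇀ p)
  A3c⁺ : Axiom p q r (+ , (p ∧ q) ⇀ q)
  A4⁺  : Axiom p q r (+ , (p ⇀ r) ⇀ ((q ⇀ r) ⇀ ((p ∨ q) ⇀ r)))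
  A5⁺  : Axiom p q r (+ , ⊤)
  A6⁺  : Axiom p q r (+ , ((p ⇀ q) ∧ r) ⇀ ((p ↽ r) ∨ q))
  A7⁺  : Axiom p q r (+ , ◇ ⊥ ⇀ ⊥)
  A8⁺  : Axiom p q r (+ , □ (p ⇀ q) ⇀ (□ p ⇀ □ q))
  A9⁺  : Axiom p q r (+ , □ p ⇀ ■ p)
  A10⁺ : Axiom p q r (+ , □ (p ⇀ q) ⇀ (⧫ p ⇀ ⧫ q))
  A11⁺ : Axiom p q r (+ , ⧫ (p ∨ q) ⇀ ((◇ p ⇀ ⧫ q) ⇀ ⧫ q))
  A12⁺ : Axiom p q r (+ , □ p ⇀ ((■ (q ↽ p) ⇀ ⧫ q) ⇀ ⧫ q))

  A1⁻  : Axiom p q r (- , (p ↽ (q ↽ r)) ↽ ((p ↽ q) ↽ (p ↽ r)))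
  A2⁻  : Axiom p q r (- , p ↽ (q ↽ p))
  A3a⁻ : Axiom p q r (- , p ↽ (q ↽ (p ∨ q)))
  A3b⁻ : Axiom p q r (- , (p ∨ q) ↽ p)
  A3c⁻ : Axiom p q r (- , (p ∨ q) ↽ q)
  A4⁻  : Axiom p q r (- , (p ↽ r) ↽ ((q ↽ r) ↽ ((p ∧ q) ↽ r)))
  A5⁻  : Axiom p q r (- , ⊥)
  A6⁻  : Axiom p q r (- , ((p ↽ q) ∨ r) ↽ ((p ⇀ r) ∧ q))
  A7⁻  : Axiom p q r (- , □ ⊤ ↽ ⊤)
  A8⁻  : Axiom p q r (- , ◇ (p ↽ q) ↽ (◇ p ↽ ◇ q))
  A9⁻  : Axiom p q r (- , ◇ p ↽ ⧫ p)
  A10⁻ : Axiom p q r (- , ◇ (p ↽ q) ↽ (■ p ↽ ■ q))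
  A11⁻ : Axiom p q r (- , ■ (p ∧ q) ↽ ((□ p ↽ ■ q) ↽ ■ q))
  A12⁻ : Axiom p q r (- , ◇ p ↽ ((⧫ (q ⇀ p) ↽ ■ q) ↽ ■ q))

record IsIML (L : Pred SFo ℓ) : Set ℓ where
  field
    substitution : ∀ {σ} → IsSubstitution σ →
                   ∀ {α A} → (α , A) ∈ L → (α , σ A) ∈ L
    rule         : ∀ {Γ s} → Rule Γ s → All L Γ → s ∈ L
    axiom        : ∀ {p q r} → p ≢ q → p ≢ r → q ≢ r →
                   Axiom (at p) (at q) (at r) ⊆ L

-- Generated by the closure conditions of IsIML; Lmin-isIML and Lmin-least show
-- that it is the least IML, among predicates of every level.
data Lmin : Pred SFo 0ℓ where
  substitution : ∀ {σ} → IsSubstitution σ →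
                 ∀ {α A} → (α , A) ∈ Lmin → (α , σ A) ∈ Lmin
  rule         : Rule Γ s → All Lmin Γ → s ∈ Lmin
  axiom        : ∀ {p q r} → p ≢ q → p ≢ r → q ≢ r →
                 Axiom (at p) (at q) (at r) s → s ∈ Lmin

Lmin-isIML : IsIML Lmin
Lmin-isIML = record
  { substitution = substitution
  ; rule         = rule
  ; axiom        = λ p≢q p≢r q≢r a → axiom p≢q p≢r q≢r a
  }

module _ {L : Pred SFo ℓ} (isIML : IsIML L) where
  private module L = IsIML isIML

  Lmin-least     : Lmin ⊆ L
  All-Lmin-least : All Lmin Γ → All L Γ

  Lmin-least (substitution σ-subst d) = L.substitution σ-subst (Lmin-least d)
  Lmin-least (rule ρ ds)              = L.rule ρ (All-Lmin-least ds)
  Lmin-least (axiom p≢q p≢r q≢r a)    = L.axiom p≢q p≢r q≢r a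

  All-Lmin-least []       = []
  All-Lmin-least (d ∷ ds) = Lmin-least d ∷ All-Lmin-least ds

{-# OPTIONS --safe #-}

-- Lmin is sound for frames (W, ≤, R) in which ⇀ and ↽ look up and down ≤, while
--   □ A: all R-successors of all points above;    ◇ A: some R-successor of some point below;
--   ⧫ A: some R-successor of every point above;   ■ A: all R-successors of some point below.
-- Completeness is by elimination of types, i.e. truth assignments to the set Σ
-- of subformulas. The invariant is that Lmin proves that some surviving type
-- holds; a type lacking a witness among the survivors is inconsistent and can
-- be removed. When nothing more can be removed, either all survivors agree that
-- the given formula holds, and it is derivable, or the survivors form a finite
-- countermodel. The exchange of signs halves the syntactic work.
module Submission where

open import Data.Bool.Base using (Bool; true; false; not; if_then_else_)
open import Data.Bool.Properties using () renaming (_≟_ to _≟ᵇ_)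
open import Data.Empty using () renaming (⊥ to Empty; ⊥-elim to Empty-elim)
open import Data.List.Base using (List; []; _∷_; _++_; foldr; map; filter; length)
import Data.List.Membership.DecPropositional as DecMembership
open import Data.List.Membership.Propositional using () renaming (_∈_ to _∈ˡ_)
open import Data.List.Membership.Propositional.Properties
  using (∈-++⁺ˡ; ∈-++⁺ʳ; ∈-++⁻; ∈-filter⁺; ∈-filter⁻; ∈-∃++; ∈-map⁺)
open import Data.List.Properties using (length-++)
open import Data.List.Relation.Binary.Subset.Propositional using () renaming (_⊆_ to _⊆ˡ_)
open import Data.List.Relation.Unary.All as All using (All; []; _∷_)
open import Data.List.Relation.Unary.Any using (here; there)
open import Data.Nat.Base using (ℕ; suc; _<_; s≤s) renaming (_≤_ to _≤ⁿ_)
open import Data.Nat.Induction using (<-wellFounded)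
open import Data.Nat.Properties using (m≤n⇒m≤1+n; +-suc; ≤-reflexive)
  renaming (_≟_ to _≟ⁿ_; ≤-refl to ≤ⁿ-refl)
open import Data.Product.Base using (_×_; _,_; proj₁; proj₂; ∃)
open import Data.Sum.Base as Sum using (_⊎_; inj₁; inj₂; swap; [_,_]′)
open import Data.Unit.Base using (tt) renaming (⊤ to Unit)
open import Defs
open import Function.Base using (_∘_; id; flip)
open import Induction.WellFounded using (WellFounded; Acc; acc; module Subrelation)
open import Level using (0ℓ)
import Relation.Binary.Construct.On as On
open import Relation.Binary.Definitions using (DecidableEquality)
open import Relation.Binary.PropositionalEquality.Core
  using (_≡_; refl; sym; trans; cong; cong₂; subst)
open import Relation.Nullary.Decidable
  using (Dec; yes; no; does; map′; _×-dec_; decidable-stable)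
open import Relation.Nullary.Negation.Core using (¬_)
open import Relation.Unary using (Pred; _∈_; _⊆_; Decidable)

private
  variable
    A B C D X Y : Fo
    b : Bool

-- Soundness

-- No condition links `R` to `_≤_`: each modal clause first moves along `_≤_` and then takes an
-- `R`-step, so persistence holds in every frame.
record Frame : Set₁ where
  infix 4 _≤_
  field
    W       : Set
    _≤_     : W → W → Set
    ≤-refl  : ∀ {w} → w ≤ w
    ≤-trans : ∀ {u v w} → u ≤ v → v ≤ w → u ≤ w
    R       : W → W → Set

module Semantics (F : Frame) where
  open Frame F

  -- Existential quantifiers and disjunctions are double negated, so that
  -- satisfaction is ¬¬-stable and soundness can be argued classically.
  imp exc or and : Pred W 0ℓ → Pred W 0ℓ → Pred W 0ℓ
  imp P Q w = ∀ {u} → w ≤ u → P u → Q u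
  exc P Q w = ¬ (∀ {u} → u ≤ w → Q u → P u)
  or  P Q w = ¬ (¬ P w × ¬ Q w)
  and P Q w = P w × Q w

  dia box bdia bbox : Pred W 0ℓ → Pred W 0ℓ
  dia  P w = ¬ (∀ {u v} → u ≤ w → R u v → ¬ P v)
  box  P w = ∀ {u v} → w ≤ u → R u v → P v
  bdia P w = ∀ {u} → w ≤ u → ¬ (∀ {v} → R u v → ¬ P v)
  bbox P w = ¬ (∀ {u} → u ≤ w → ¬ (∀ {v} → R u v → P v))

  Sat : (At → Pred W 0ℓ) → Fo → Pred W 0ℓ
  Sat V (at p)  = V p
  Sat V (A ⇀ B) = imp (Sat V A) (Sat V B)
  Sat V (A ↽ B) = exc (Sat V A) (Sat V B)
  Sat V (A ∨ B) = or (Sat V A) (Sat V B)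
  Sat V (A ∧ B) = and (Sat V A) (Sat V B)
  Sat V ⊤       = λ _ → Unit
  Sat V ⊥       = λ _ → Empty
  Sat V (◇ A)   = dia (Sat V A)
  Sat V (□ A)   = box (Sat V A)
  Sat V (⧫ A)   = bdia (Sat V A)
  Sat V (■ A)   = bbox (Sat V A)

  Stable Persistent : Pred W 0ℓ → Set
  Stable P     = ∀ {w} → ¬ ¬ P w → P w
  Persistent P = ∀ {w u} → w ≤ u → P w → P u

  record IsValuation (V : At → Pred W 0ℓ) : Set where
    field
      stable     : ∀ p → Stable (V p)
      persistent : ∀ p → Persistent (V p)

  module _ {V : At → Pred W 0ℓ} (val : IsValuation V) where
    open IsValuation val

    Sat-stable : ∀ A → Stable (Sat V A)
    Sat-stable (at p)  k = stable p k
    Sat-stable (A ⇀ B) k = λ w≤u a → Sat-stable B (λ ¬b → k (λ f → ¬b (f w≤u a)))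
    Sat-stable (A ↽ B) k = λ f → k (λ e → e f)
    Sat-stable (A ∨ B) k = λ f → k (λ e → e f)
    Sat-stable (A ∧ B) k = Sat-stable A (λ ¬a → k (¬a ∘ proj₁)) , Sat-stable B (λ ¬b → k (¬b ∘ proj₂))
    Sat-stable ⊤       k = tt
    Sat-stable ⊥       k = k (λ ())
    Sat-stable (◇ A)   k = λ f → k (λ e → e f)
    Sat-stable (□ A)   k = λ w≤u r → Sat-stable A (λ ¬a → k (λ f → ¬a (f w≤u r)))
    Sat-stable (⧫ A)   k = λ w≤u f → k (λ e → e w≤u f)
    Sat-stable (■ A)   k = λ f → k (λ e → e f)

    Sat-persistent : ∀ A → Persistent (Sat V A)
    Sat-persistent (at p)  w≤u = persistent p w≤u
    Sat-persistent (A ⇀ B) w≤u f = λ u≤v → f (≤-trans w≤u u≤v)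
    Sat-persistent (A ↽ B) w≤u e = λ f → e (λ v≤w → f (≤-trans v≤w w≤u))
    Sat-persistent (A ∨ B) w≤u e =
      λ (¬a , ¬b) → e (¬a ∘ Sat-persistent A w≤u , ¬b ∘ Sat-persistent B w≤u)
    Sat-persistent (A ∧ B) w≤u (a , b) = Sat-persistent A w≤u a , Sat-persistent B w≤u b
    Sat-persistent ⊤       w≤u _ = tt
    Sat-persistent ⊥       w≤u ()
    Sat-persistent (◇ A)   w≤u e = λ f → e (λ v≤w → f (≤-trans v≤w w≤u))
    Sat-persistent (□ A)   w≤u f = λ u≤v → f (≤-trans w≤u u≤v)
    Sat-persistent (⧫ A)   w≤u f = λ u≤v → f (≤-trans w≤u u≤v)
    Sat-persistent (■ A)   w≤u e = λ f → e (λ v≤w → f (≤-trans v≤w w≤u))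

    module _ {σ : Fo → Fo} (σ-subst : IsSubstitution σ) where
      open IsSubstitution σ-subst

      pullback : At → Pred W 0ℓ
      pullback p = Sat V (σ (at p))

      pullback-isValuation : IsValuation pullback
      pullback-isValuation = record
        { stable     = λ p → Sat-stable (σ (at p))
        ; persistent = λ p → Sat-persistent (σ (at p))
        }

      -- Since each clause of `Sat` is an operator on predicates, congruence gives equality of
      -- predicates without function extensionality.
      Sat-pullback : ∀ A → Sat pullback A ≡ Sat V (σ A)
      Sat-pullback (at p)  = refl
      Sat-pullback (A ⇀ B) = trans (cong₂ imp (Sat-pullback A) (Sat-pullback B))
                                   (cong (Sat V) (sym (⇀-homo A B)))
      Sat-pullback (A ↽ B) = trans (cong₂ exc (Sat-pullback A) (Sat-pullback B))
                                   (cong (Sat V) (sym (↽-homo A B)))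
      Sat-pullback (A ∨ B) = trans (cong₂ or (Sat-pullback A) (Sat-pullback B))
                                   (cong (Sat V) (sym (∨-homo A B)))
      Sat-pullback (A ∧ B) = trans (cong₂ and (Sat-pullback A) (Sat-pullback B))
                                   (cong (Sat V) (sym (∧-homo A B)))
      Sat-pullback ⊤       = cong (Sat V) (sym ⊤-homo)
      Sat-pullback ⊥       = cong (Sat V) (sym ⊥-homo)
      Sat-pullback (◇ A)   = trans (cong dia (Sat-pullback A)) (cong (Sat V) (sym (◇-homo A)))
      Sat-pullback (□ A)   = trans (cong box (Sat-pullback A)) (cong (Sat V) (sym (□-homo A)))
      Sat-pullback (⧫ A)   = trans (cong bdia (Sat-pullback A)) (cong (Sat V) (sym (⧫-homo A)))
      Sat-pullback (■ A)   = trans (cong bbox (Sat-pullback A)) (cong (Sat V) (sym (■-homo A)))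

  Holds : (At → Pred W 0ℓ) → Pred SFo 0ℓ
  Holds V (+ , A) = ∀ w → Sat V A w
  Holds V (- , A) = ∀ w → ¬ Sat V A w

  Valid : Pred SFo _
  Valid s = ∀ {V} → IsValuation V → Holds V s

  Valid-substitution : ∀ {σ} → IsSubstitution σ → ∀ {α A} → (α , A) ∈ Valid → (α , σ A) ∈ Valid
  Valid-substitution σ-subst {+} {A} a {V} val w =
    subst (λ P → P w) (Sat-pullback val σ-subst A) (a (pullback-isValuation val σ-subst) w)
  Valid-substitution σ-subst { - } {A} a {V} val w =
    subst (λ P → ¬ P w) (Sat-pullback val σ-subst A) (a (pullback-isValuation val σ-subst) w)

  Holds-rule : ∀ {V} → IsValuation V → ∀ {Γ s} → Rule Γ s → All (Holds V) Γ → Holds V s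
  Holds-rule val R1⁺ (a ∷ f ∷ []) w = f w ≤-refl (a w)
  Holds-rule val R1⁻ (¬a ∷ ¬e ∷ []) w b = ¬e w (λ f → ¬a w (f ≤-refl b))
  Holds-rule val (R2⁺ {A}) (¬e ∷ []) w {u} w≤u b =
    Sat-stable val A λ ¬a → ¬e u (λ f → ¬a (f ≤-refl b))
  Holds-rule val R2⁻ (f ∷ []) w e = e (λ {u} _ a → f u ≤-refl a)
  Holds-rule val R3⁺ (f ∷ []) w w≤u e = λ h → e (λ v≤u r a → h v≤u r (f _ ≤-refl a))
  Holds-rule val (R3⁻ {A}) (¬e ∷ []) w k =
    k (λ u≤w b v≤ r → Sat-stable val A λ ¬a → ¬e _ (λ f → ¬a (f ≤-refl (b v≤ r))))
  Holds-rule val R4⁺ (a ∷ []) w w≤u r = a _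
  Holds-rule val R4⁻ (¬a ∷ []) w k = k (λ u≤w r → ¬a _)
  Holds-rule val R5⁺ (f ∷ []) w w≤u e u≤v h = e u≤v (λ r a → h r (f _ ≤-refl a))
  Holds-rule val (R5⁻ {A}) (¬e ∷ []) w k =
    k (λ u≤w b h → b (λ v≤u g → h v≤u (λ r → Sat-stable val A λ ¬a → ¬e _ (λ f → ¬a (f ≤-refl (g r))))))
  Holds-rule val R6⁺ (a ∷ []) w = λ h → h ≤-refl (λ r → a _)
  Holds-rule val R6⁻ (¬a ∷ []) w b = b ≤-refl (λ r → ¬a _)
  -- If `B` fails at every `R`-successor of `v`, the premise makes `A` true at all of them; this
  -- gives `■ A` at `v`, and `f` applies.
  Holds-rule val (R7⁺ {A}) (a∨b ∷ []) w w≤u f {v} u≤v ¬b =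
    f u≤v (λ h → h ≤-refl (λ r → Sat-stable val A λ ¬a → a∨b _ (¬a , ¬b r))) ≤-refl ¬b
  Holds-rule val R7⁻ (¬ab ∷ []) w k =
    k (λ u≤w b e → b (λ v≤u g → e v≤u (λ h → h ≤-refl g) ≤-refl (λ r a → ¬ab _ (a , g r))))
  -- The premise is applied at the lower point that witnesses `◇ A`: from there `B` persists
  -- upwards, and `□ C` puts `C` on the successor satisfying `A`.
  Holds-rule val (R8⁺ {B = B}) (f ∷ []) w w≤u e (¬b , ¬c) =
    e (λ v≤u r a → f _ ≤-refl (λ h → h ≤-refl r a)
        ((λ b → ¬b (Sat-persistent val B v≤u b)) , (λ c → ¬c (λ h → h v≤u r (a , c ≤-refl r)))))
  Holds-rule val (R8⁻ {A} {B}) (¬e ∷ []) w k =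
    k (λ {u} u≤w (b , c) {x} {v} u≤x r → Sat-stable val A λ ¬a →
      ¬e x (λ h → ¬a (h ≤-refl (Sat-persistent val B u≤x b , λ g → c u≤x r (¬a , g ≤-refl r)) ≤-refl r)))

  Holds-axiom : ∀ {V} → IsValuation V → ∀ {p q r} → Axiom (at p) (at q) (at r) ⊆ Holds V
  Holds-axiom {V} val {p} {q} {r} = λ where
      A1⁺  w _ f u≤v g v≤z a → f (≤-trans u≤v v≤z) a ≤-refl (g v≤z a)
      A2⁺  w _ a u≤v _ → up p u≤v a
      A3a⁺ w _ a u≤v b → up p u≤v a , b
      A3b⁺ w _ → proj₁
      A3c⁺ w _ → proj₂
      A4⁺  w _ f u≤v g v≤w e → st r λ ¬c → e (¬c ∘ f (≤-trans u≤v v≤w) , ¬c ∘ g v≤w)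
      A5⁺  w → tt
      A6⁺  w _ (f , c) (¬e , ¬b) → ¬e (λ h → ¬b (f ≤-refl (h ≤-refl c)))
      A7⁺  w _ e → e (λ _ _ ())
      A8⁺  w _ f u≤v g v≤w r → f (≤-trans u≤v v≤w) r ≤-refl (g v≤w r)
      A9⁺  w _ f h → h ≤-refl (f ≤-refl)
      A10⁺ w _ f u≤v g v≤w h → g v≤w (λ r a → h r (f (≤-trans u≤v v≤w) r ≤-refl a))
      -- In `A11⁺` and `A12⁺`, `h` says that `q` fails at all successors. Then, respectively, some
      -- successor satisfies `p`, or every successor is its own witness for `q ↽ p`; so `g` yields
      -- `⧫ q`.
      A11⁺ w _ e u≤v g v≤w h → e (≤-trans u≤v v≤w)
             (λ r a∨b → a∨b ((λ a → g v≤w (λ k → k ≤-refl r a) ≤-refl h) , h r))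
      A12⁺ w _ f u≤v g v≤w h →
             g v≤w (λ k → k ≤-refl (λ r j → h r (j ≤-refl (f (≤-trans u≤v v≤w) r)))) ≤-refl h
      A1⁻  w k → k λ _ x h → x λ v≤u y g → y λ z≤v c → st p λ ¬a →
             ¬a (h (≤-trans z≤v v≤u) (λ j → ¬a (g z≤v (j ≤-refl c))))
      A2⁻  w k → k λ _ e → st p λ ¬a → e λ v≤u a → Empty-elim (¬a (up p v≤u a))
      A3a⁻ w k → k λ _ e → st p λ ¬a → e λ v≤u a∨b → st q λ ¬b → a∨b (¬a ∘ up p v≤u , ¬b)
      A3b⁻ w k → k λ _ a (¬a , _) → ¬a a
      A3c⁻ w k → k λ _ b (_ , ¬b) → ¬b b
      A4⁻  w k → k λ _ x h → x λ v≤u y g → y λ z≤v c → h (≤-trans z≤v v≤u) c , g z≤v c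
      A5⁻  w ()
      A6⁻  w k → k λ _ (f , b) (¬e , ¬c) → ¬e λ h → ¬c (f ≤-refl (h ≤-refl b))
      A7⁻  w k → k λ _ _ _ _ → tt
      A8⁻  w k → k λ _ x h → x λ v≤u e g → e λ y≤v r b →
             h (≤-trans y≤v v≤u) r λ j → g y≤v r (j ≤-refl b)
      A9⁻  w k → k λ _ e h → e ≤-refl (h ≤-refl)
      A10⁻ w k → k λ _ x h → x λ v≤u e g → e λ y≤v b → g y≤v λ r → st p λ ¬a →
             h (≤-trans y≤v v≤u) r λ j → ¬a (j ≤-refl (b r))
      A11⁻ w k → k λ _ x h → x λ v≤u e g → e λ y≤v b →
             h (≤-trans y≤v v≤u) λ r → g y≤v (λ j → j ≤-refl b) ≤-refl r , b r
      A12⁻ w k → k λ _ x h → x λ v≤u e g → e λ y≤v b →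
             g y≤v (λ j → j ≤-refl b) ≤-refl λ r f → h (≤-trans y≤v v≤u) r (f ≤-refl (b r))
    where
    st = IsValuation.stable val
    up = IsValuation.persistent val

  Valid-isIML : IsIML Valid
  Valid-isIML = record
    { substitution = Valid-substitution
    ; rule         = λ ρ vs val → Holds-rule val ρ (All.map (λ v → v val) vs)
    ; axiom        = λ _ _ _ a val → Holds-axiom val a
    }

-- Syntactic derivations

record Connectives : Set where
  infixr 6 _⊃_ _⊂_
  infix  7 _⊓_ _⊔_
  field
    _⊃_ _⊂_ _⊓_ _⊔_ : Fo → Fo → Fo
    𝟙 𝟘             : Fo
    dia box bdia bbox : Fo → Fo

dual : Connectives → Connectives
dual K = record
  { _⊃_ = _⊂_ ; _⊂_ = _⊃_ ; _⊓_ = _⊔_ ; _⊔_ = _⊓_ ; 𝟙 = 𝟘 ; 𝟘 = 𝟙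
  ; dia = box ; box = dia ; bdia = bbox ; bbox = bdia }
  where open Connectives K

-- The part of the positive rules and axioms that completeness needs. Read in
-- the dual connectives, it is the corresponding part of the negative ones.
record Calculus (K : Connectives) (⊢_ : Pred Fo 0ℓ) : Set where
  open Connectives K
  field
    mp       : ⊢ A → ⊢ (A ⊃ B) → ⊢ B
    ax-S     : ⊢ ((A ⊃ (B ⊃ C)) ⊃ ((A ⊃ B) ⊃ (A ⊃ C)))
    ax-K     : ⊢ (A ⊃ (B ⊃ A))
    ax-pair  : ⊢ (A ⊃ (B ⊃ (A ⊓ B)))
    ax-fst   : ⊢ ((A ⊓ B) ⊃ A)
    ax-snd   : ⊢ ((A ⊓ B) ⊃ B)
    ax-case  : ⊢ ((A ⊃ C) ⊃ ((B ⊃ C) ⊃ ((A ⊔ B) ⊃ C)))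
    ax-𝟙     : ⊢ 𝟙
    box-nec  : ⊢ A → ⊢ (box A)
    box-K    : ⊢ (box (A ⊃ B) ⊃ (box A ⊃ box B))
    box-bbox : ⊢ (box A ⊃ bbox A)
    box-bdia : ⊢ (box (A ⊃ B) ⊃ (bdia A ⊃ bdia B))
    bdia-⊔   : ⊢ (bdia (A ⊔ B) ⊃ ((dia A ⊃ bdia B) ⊃ bdia B))
    bbox-⊂   : ⊢ (box A ⊃ ((bbox (B ⊂ A) ⊃ bdia B) ⊃ bdia B))
    bdia-map : ⊢ (A ⊃ B) → ⊢ (bdia A ⊃ bdia B)
    dia-box  : ⊢ (dia A ⊃ (B ⊔ box C)) → ⊢ (dia A ⊃ (B ⊔ dia (A ⊓ C)))

module CalculusProperties {K : Connectives} {⊢_ : Pred Fo 0ℓ} (calculus : Calculus K ⊢_) where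
  open Connectives K
  open Calculus calculus

  infix 4 _≤_
  _≤_ : Fo → Fo → Set
  A ≤ B = ⊢ (A ⊃ B)

  const : ⊢ A → X ≤ A
  const a = mp a ax-K

  app : X ≤ (A ⊃ B) → X ≤ A → X ≤ B
  app f a = mp a (mp f ax-S)

  ≤-refl : A ≤ A
  ≤-refl {A} = app {A = A ⊃ A} ax-K ax-K

  ≤-trans : A ≤ B → B ≤ C → A ≤ C
  ≤-trans f g = app (const g) f

  ⟨_,_⟩ : X ≤ A → X ≤ B → X ≤ A ⊓ B
  ⟨ f , g ⟩ = app (app (const ax-pair) f) g

  curry : X ⊓ A ≤ B → X ≤ A ⊃ B
  curry f = ≤-trans ax-pair (mp (const f) ax-S)

  [_,_] : A ≤ C → B ≤ C → A ⊔ B ≤ C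
  [ f , g ] = mp g (mp f ax-case)

  box-map : A ≤ B → box A ≤ box B
  box-map f = mp (box-nec f) box-K

  box-⊓ : X ≤ box A → X ≤ box B → X ≤ box (A ⊓ B)
  box-⊓ f g = app (≤-trans (≤-trans f (box-map ax-pair)) box-K) g

  ⋀ : List Fo → Fo
  ⋀ = foldr _⊓_ 𝟙

  ⋀-lower : ∀ {l} → A ∈ˡ l → ⋀ l ≤ A
  ⋀-lower (here refl) = ax-fst
  ⋀-lower (there A∈l) = ≤-trans ax-snd (⋀-lower A∈l)

  box-⋀ : ∀ l → (∀ {A} → A ∈ˡ l → X ≤ box A) → X ≤ box (⋀ l)
  box-⋀ []      f = const (box-nec ax-𝟙)
  box-⋀ (A ∷ l) f = box-⊓ (f (here refl)) (box-⋀ l (f ∘ there))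

record Logic : Set₁ where
  field
    connectives : Connectives
    ⊢_ ⊣_       : Pred Fo 0ℓ
    positive    : Calculus connectives ⊢_
    negative    : Calculus (dual connectives) ⊣_
  open Connectives connectives
  field
    ⊣⇒⊢ : ⊣ (A ⊂ B) → ⊢ (B ⊃ A)
    ⊢⇒⊣ : ⊢ (A ⊃ B) → ⊣ (B ⊂ A)

dualLogic : Logic → Logic
dualLogic 𝓛 = record
  { connectives = dual connectives
  ; ⊢_ = ⊣_ ; ⊣_ = ⊢_
  ; positive = negative ; negative = positive
  ; ⊣⇒⊢ = ⊢⇒⊣ ; ⊢⇒⊣ = ⊣⇒⊢ }
  where open Logic 𝓛

-- Laws that `Calculus` states only for the dual connectives are obtained by reading the negative
-- calculus through `⊣⇒⊢`, which reverses the order.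
module LogicProperties (𝓛 : Logic) where
  open Logic 𝓛 public
  open Connectives connectives public
  open Calculus positive public
  open CalculusProperties positive public
  private
    module N  = Calculus negative
    module N′ = CalculusProperties negative

  ⊔-inl : A ≤ A ⊔ B
  ⊔-inl = ⊣⇒⊢ N.ax-fst

  ⊔-inr : B ≤ A ⊔ B
  ⊔-inr = ⊣⇒⊢ N.ax-snd

  ⊂-residual : B ≤ A ⊔ C → C ⊂ B ≤ A
  ⊂-residual = ⊣⇒⊢ ∘ N′.curry ∘ ⊢⇒⊣

  cut : X ≤ A ⊔ B → X ⊓ B ≤ A → X ≤ A
  cut f g = app (≤-trans f [ ax-K , curry (≤-trans ⟨ ax-snd , ax-fst ⟩ g) ]) ≤-refl

  bbox-map : A ≤ B → bbox A ≤ bbox B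
  bbox-map = ⊣⇒⊢ ∘ N.bdia-map ∘ ⊢⇒⊣

  bdia⇒dia : bdia A ≤ dia A
  bdia⇒dia = ⊣⇒⊢ N.box-bbox

  ⋁ : List Fo → Fo
  ⋁ = N′.⋀

  ⋁-upper : ∀ {l} → A ∈ˡ l → A ≤ ⋁ l
  ⋁-upper = ⊣⇒⊢ ∘ N′.⋀-lower

  dia-⋁ : ∀ l → (∀ {A} → A ∈ˡ l → dia A ≤ X) → dia (⋁ l) ≤ X
  dia-⋁ l f = ⊣⇒⊢ (N′.box-⋀ l (⊢⇒⊣ ∘ f))

  box-dia : B ⊓ dia C ≤ box A → B ⊓ box (A ⊔ C) ≤ box A
  box-dia = ⊣⇒⊢ ∘ N.dia-box ∘ ⊢⇒⊣

  bdia-cut : X ≤ bdia (A ⊔ C) → X ⊓ dia A ≤ bdia C → X ≤ bdia C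
  bdia-cut f g = app (≤-trans f bdia-⊔) (curry g)

  box-bdia-mono : A ⊓ C ≤ B → X ≤ box A → X ≤ bdia C → X ≤ bdia B
  box-bdia-mono h f g = app (≤-trans (≤-trans f (box-map (curry h))) box-bdia) g

  -- The axiom `bbox-⊂` in the form of a cut. In a frame, all successors satisfy `D` or `B`; if `B`
  -- failed at all of them, `bbox D` would hold and give `bdia B`.
  bbox-cut : A ≤ D ⊔ B → X ≤ box A → X ⊓ bbox D ≤ bdia B → X ≤ bdia B
  bbox-cut h f g =
    app (≤-trans f bbox-⊂)
        (curry (≤-trans ⟨ ax-fst , ≤-trans ax-snd (bbox-map (⊂-residual h)) ⟩ g))

-- Axiom instances and the two calculi of `Lmin`

subst-at : (At → Fo) → Fo → Fo
subst-at f (at p)  = f p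
subst-at f (A ⇀ B) = subst-at f A ⇀ subst-at f B
subst-at f (A ↽ B) = subst-at f A ↽ subst-at f B
subst-at f (A ∨ B) = subst-at f A ∨ subst-at f B
subst-at f (A ∧ B) = subst-at f A ∧ subst-at f B
subst-at f ⊤       = ⊤
subst-at f ⊥       = ⊥
subst-at f (◇ A)   = ◇ subst-at f A
subst-at f (□ A)   = □ subst-at f A
subst-at f (⧫ A)   = ⧫ subst-at f A
subst-at f (■ A)   = ■ subst-at f A

subst-at-isSubstitution : ∀ f → IsSubstitution (subst-at f)
subst-at-isSubstitution f = record
  { ⇀-homo = λ _ _ → refl ; ↽-homo = λ _ _ → refl
  ; ⊤-homo = refl ; ⊥-homo = refl
  ; ∨-homo = λ _ _ → refl ; ∧-homo = λ _ _ → refl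
  ; ◇-homo = λ _ → refl ; □-homo = λ _ → refl
  ; ⧫-homo = λ _ → refl ; ■-homo = λ _ → refl
  }

assign : Fo → Fo → Fo → At → Fo
assign A B C 0 = A
assign A B C 1 = B
assign A B C _ = C

-- The axioms are given for distinct atoms only; substituting for the atoms 0, 1, 2 turns them into
-- schemes.
instantiate : ∀ {α X} → Axiom (at 0) (at 1) (at 2) (α , X) → ∀ A B C →
              (α , subst-at (assign A B C) X) ∈ Lmin
instantiate a A B C =
  substitution (subst-at-isSubstitution (assign A B C)) (axiom (λ ()) (λ ()) (λ ()) a)

fo-connectives : Connectives
fo-connectives = record
  { _⊃_ = _⇀_ ; _⊂_ = _↽_ ; _⊓_ = _∧_ ; _⊔_ = _∨_ ; 𝟙 = ⊤ ; 𝟘 = ⊥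
  ; dia = ◇_ ; box = □_ ; bdia = ⧫_ ; bbox = ■_ }

Lmin-positive : Calculus fo-connectives (λ A → (+ , A) ∈ Lmin)
Lmin-positive = record
  { mp       = λ a f → rule R1⁺ (a ∷ f ∷ [])
  ; ax-S     = instantiate A1⁺ _ _ _
  -- Here and below `⊤` is a default for atoms absent from the axiom.
  ; ax-K     = instantiate A2⁺ _ _ ⊤
  ; ax-pair  = instantiate A3a⁺ _ _ ⊤
  ; ax-fst   = instantiate A3b⁺ _ _ ⊤
  ; ax-snd   = instantiate A3c⁺ _ _ ⊤
  ; ax-case  = instantiate A4⁺ _ _ _
  ; ax-𝟙     = instantiate A5⁺ ⊤ ⊤ ⊤
  ; box-nec  = λ a → rule R4⁺ (a ∷ [])
  ; box-K    = instantiate A8⁺ _ _ ⊤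
  ; box-bbox = instantiate A9⁺ _ ⊤ ⊤
  ; box-bdia = instantiate A10⁺ _ _ ⊤
  ; bdia-⊔   = instantiate A11⁺ _ _ ⊤
  ; bbox-⊂   = instantiate A12⁺ _ _ ⊤
  ; bdia-map = λ f → rule R5⁺ (f ∷ [])
  ; dia-box  = λ f → rule R8⁺ (f ∷ [])
  }

Lmin-negative : Calculus (dual fo-connectives) (λ A → (- , A) ∈ Lmin)
Lmin-negative = record
  { mp       = λ a f → rule R1⁻ (a ∷ f ∷ [])
  ; ax-S     = instantiate A1⁻ _ _ _
  ; ax-K     = instantiate A2⁻ _ _ ⊤
  ; ax-pair  = instantiate A3a⁻ _ _ ⊤
  ; ax-fst   = instantiate A3b⁻ _ _ ⊤
  ; ax-snd   = instantiate A3c⁻ _ _ ⊤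
  ; ax-case  = instantiate A4⁻ _ _ _
  ; ax-𝟙     = instantiate A5⁻ ⊤ ⊤ ⊤
  ; box-nec  = λ a → rule R4⁻ (a ∷ [])
  ; box-K    = instantiate A8⁻ _ _ ⊤
  ; box-bbox = instantiate A9⁻ _ ⊤ ⊤
  ; box-bdia = instantiate A10⁻ _ _ ⊤
  ; bdia-⊔   = instantiate A11⁻ _ _ ⊤
  ; bbox-⊂   = instantiate A12⁻ _ _ ⊤
  ; bdia-map = λ f → rule R5⁻ (f ∷ [])
  ; dia-box  = λ f → rule R8⁻ (f ∷ [])
  }

Lmin-logic : Logic
Lmin-logic = record
  { connectives = fo-connectives
  ; ⊢_ = λ A → (+ , A) ∈ Lmin ; ⊣_ = λ A → (- , A) ∈ Lmin
  ; positive = Lmin-positive ; negative = Lmin-negative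
  ; ⊣⇒⊢ = λ a → rule R2⁺ (a ∷ []) ; ⊢⇒⊣ = λ a → rule R2⁻ (a ∷ []) }

-- Inconsistent types

module _ {Z : Set} where
  Some Every : List Z → (Z → Set) → Set
  Some  l P = ∃ λ x → x ∈ˡ l × P x
  Every l P = ∀ x → x ∈ˡ l → P x

  every⊎ : {P : Z → Set} {Q : Set} → ∀ l → (∀ x → x ∈ˡ l → P x ⊎ Q) → Every l P ⊎ Q
  every⊎ []      f = inj₁ λ _ ()
  every⊎ (x ∷ l) f with f x (here refl) | every⊎ l (λ y → f y ∘ there)
  ... | inj₂ q | _      = inj₂ q
  ... | inj₁ _ | inj₂ q = inj₂ q
  ... | inj₁ p | inj₁ g = inj₁ λ { _ (here refl) → p ; y (there y∈l) → g y y∈l }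

  -- Failure of `P` is expressed by a positive alternative `Q`, so an unsuccessful search returns
  -- the evidence from which inconsistency is derived.
  some⊎every : {P Q : Z → Set} → ∀ l → (∀ x → P x ⊎ Q x) → Some l P ⊎ Every l Q
  some⊎every l f = swap (every⊎ l λ x x∈l → swap (Sum.map₁ (λ p → x , x∈l , p) (f x)))

×⊎ : {P P′ Q Q′ : Set} → P ⊎ Q → P′ ⊎ Q′ → (P × P′) ⊎ (Q ⊎ Q′)
×⊎ (inj₁ p) (inj₁ p′) = inj₁ (p , p′)
×⊎ (inj₁ _) (inj₂ q′) = inj₂ (inj₂ q′)
×⊎ (inj₂ q) _         = inj₂ (inj₁ q)

-- Only the values on the finite set Σ below matter.
Ty : Set
Ty = Fo → Bool

-- Truth and falsity at a type are kept as two predicates `Pos` and `Neg`, so exchanging signs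
-- permutes the fields, and every check proved for a setting also holds for its dual.
record Setting : Set₁ where
  field
    logic : Logic
    Σ     : List Fo
    S     : List Ty
    Pos Neg : Ty → Fo → Set
    pos⊎neg  : ∀ u A → Pos u A ⊎ Neg u A
    disjoint : ∀ {u A} → Pos u A → Neg u A → Empty

  open LogicProperties logic

  field
    un-box un-dia un-bdia un-bbox : Ty → List Fo
    un-box⁻  : ∀ {u} → A ∈ˡ un-box u → A ∈ˡ Σ × box A ∈ˡ Σ × Pos u (box A)
    un-dia⁻  : ∀ {u} → A ∈ˡ un-dia u → A ∈ˡ Σ × dia A ∈ˡ Σ × Neg u (dia A)
    un-bdia⁻ : ∀ {u} → A ∈ˡ un-bdia u → A ∈ˡ Σ × bdia A ∈ˡ Σ × Pos u (bdia A)
    un-bbox⁻ : ∀ {u} → A ∈ˡ un-bbox u → A ∈ˡ Σ × bbox A ∈ˡ Σ × Neg u (bbox A)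

    _⊑_     : Ty → Ty → Set
    ⊑-pos   : ∀ {u v} → u ⊑ v → A ∈ˡ Σ → Pos u A → Pos v A
    ⊑-neg   : ∀ {u v} → u ⊑ v → A ∈ˡ Σ → Neg v A → Neg u A
    ⊑-refl  : ∀ {u} → u ⊑ u
    ⊑-trans : ∀ {u v w} → u ⊑ v → v ⊑ w → u ⊑ w
    ⊑⊎      : ∀ u v → u ⊑ v ⊎ Some Σ (λ A → Pos u A × Neg v A)

    Compat  : Ty → Ty → Set
    compat⊎ : ∀ u v → Compat u v ⊎ (Some (un-box u) (Neg v) ⊎ Some (un-dia u) (Pos v))

    ascending  : WellFounded (λ v u → u ⊑ v × Some Σ (λ A → Neg u A × Pos v A))
    descending : WellFounded (λ v u → v ⊑ u × Some Σ (λ A → Pos u A × Neg v A))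

  Below Above : Ty → Fo → Set
  Below u X = ∀ {A} → A ∈ˡ Σ → Pos u A → X ≤ A
  Above u Y = ∀ {A} → A ∈ˡ Σ → Neg u A → A ≤ Y

  -- ⋀ (positive formulas of u) ≤ ⋁ (negative formulas of u), stated without
  -- meets and joins so that it is visibly self-dual.
  Inconsistent : Ty → Set
  Inconsistent u = ∀ {X Y} → Below u X → Above u Y → X ≤ Y

  -- X ≤ Y in the presence of the characteristic formula of u; Covering thus says
  -- that these formulas, for u in S, have disjunction ⊤.
  Relative : Ty → Fo → Fo → Set
  Relative u X Y = ∀ {X′ Y′} → X′ ≤ X → Y ≤ Y′ → Below u X′ → Above u Y′ → X′ ≤ Y′

  Covering : Set
  Covering = ∀ {X Y} → (∀ {u} → u ∈ˡ S → Relative u X Y) → X ≤ Y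

  -- `L` plays the role of a list of admissible successors: it has to contain the witnesses that `u`
  -- demands by a true `bdia D` or a false `bbox D`.
  GoodBdia GoodBbox : List Ty → Ty → Set
  GoodBdia L u = Every (un-bdia u) (λ D → Some L (λ v → Compat u v × Pos v D))
  GoodBbox L u = Every (un-bbox u) (λ D → Some L (λ v → Compat u v × Neg v D))

dualSetting : Setting → Setting
dualSetting 𝓢 = record
  { logic = dualLogic logic
  ; Σ = Σ ; S = S ; Pos = Neg ; Neg = Pos
  ; pos⊎neg = λ u A → swap (pos⊎neg u A) ; disjoint = flip disjoint
  ; un-box = un-dia ; un-dia = un-box ; un-bdia = un-bbox ; un-bbox = un-bdia
  ; un-box⁻ = un-dia⁻ ; un-dia⁻ = un-box⁻ ; un-bdia⁻ = un-bbox⁻ ; un-bbox⁻ = un-bdia⁻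
  ; _⊑_ = flip _⊑_ ; ⊑-pos = ⊑-neg ; ⊑-neg = ⊑-pos ; ⊑-refl = ⊑-refl ; ⊑-trans = flip ⊑-trans
  ; ⊑⊎ = λ u v → Sum.map₂ (λ (A , A∈ , p , n) → A , A∈ , n , p) (⊑⊎ v u)
  ; Compat = Compat ; compat⊎ = λ u v → Sum.map₂ swap (compat⊎ u v)
  ; ascending = descending ; descending = ascending
  }
  where open Setting 𝓢

module Dual (𝓢 : Setting) where
  open Setting 𝓢
  open Logic logic
  private
    module D = Setting (dualSetting 𝓢)

  inconsistent-dual : ∀ {u} → D.Inconsistent u → Inconsistent u
  inconsistent-dual i below above =
    ⊣⇒⊢ (i (λ A∈Σ n → ⊢⇒⊣ (above A∈Σ n)) (λ A∈Σ p → ⊢⇒⊣ (below A∈Σ p)))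

  covering-dual : Covering → D.Covering
  covering-dual c f =
    ⊢⇒⊣ (c λ u∈S X≤ ≤Y below above → ⊣⇒⊢
      (f u∈S (⊢⇒⊣ ≤Y) (⊢⇒⊣ X≤) (λ A∈Σ n → ⊢⇒⊣ (above A∈Σ n)) (λ A∈Σ p → ⊢⇒⊣ (below A∈Σ p))))

-- Inconsistency of types that lack a witness

module Elimination (𝓢 : Setting) (covering : Setting.Covering 𝓢) where
  open Setting 𝓢
  open LogicProperties logic

  Separated : Fo → Fo → Ty → Set
  Separated X Y v =
    Some Σ (λ A → X ≤ A × Neg v A) ⊎ Some Σ (λ A → A ≤ Y × Pos v A) ⊎ Inconsistent v

  -- `covering` serves as a case distinction over `S`. A separating formula settles its case:
  -- `X′ ≤ X ≤ A ≤ Y′` if `v` rejects `A`, and `X′ ≤ A ≤ Y ≤ Y′` if `v` accepts it.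
  separate : Every S (Separated X Y) → X ≤ Y
  separate s = covering λ {v} v∈S X≤ ≤Y below above → case (s v v∈S) X≤ ≤Y below above
    where
    case : ∀ {X Y v} → Separated X Y v → Relative v X Y
    case (inj₁ (A , A∈Σ , X≤A , n)) X≤ ≤Y below above = ≤-trans (≤-trans X≤ X≤A) (above A∈Σ n)
    case (inj₂ (inj₁ (A , A∈Σ , A≤Y , p))) X≤ ≤Y below above = ≤-trans (below A∈Σ p) (≤-trans A≤Y ≤Y)
    case (inj₂ (inj₂ i)) X≤ ≤Y below above = i below above

  Clash : Ty → Ty → Set
  Clash u v = Some (un-box u) (Neg v) ⊎ Some (un-dia u) (Pos v)

  clash-separated : ∀ {u v} → X ≤ ⋀ (un-box u) → ⋁ (un-dia u) ≤ Y → Clash u v → Separated X Y v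
  clash-separated X≤ ≤Y (inj₁ (A , A∈ , n)) =
    inj₁ (A , proj₁ (un-box⁻ A∈) , ≤-trans X≤ (⋀-lower A∈) , n)
  clash-separated X≤ ≤Y (inj₂ (A , A∈ , p)) =
    inj₂ (inj₁ (A , proj₁ (un-dia⁻ A∈) , ≤-trans (⋁-upper A∈) ≤Y , p))

  below-box : ∀ {u} → Below u X → X ≤ box (⋀ (un-box u))
  below-box {u = u} below =
    box-⋀ (un-box u) λ A∈ → let _ , □A∈Σ , p = un-box⁻ A∈ in below □A∈Σ p

  above-dia : ∀ {u} → Above u Y → dia (⋁ (un-dia u)) ≤ Y
  above-dia {u = u} above =
    dia-⋁ (un-dia u) λ A∈ → let _ , ◇A∈Σ , n = un-dia⁻ A∈ in above ◇A∈Σ n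

  -- Without a witness, each type in `S` misses a true formula of `t`, misses `A` or contains `B`.
  -- In each case it is separated for `X ⊓ A ≤ B`, so `X` entails `A ⊃ B`, which `t` rejects.
  check-⊃ : ∀ {t} → (A ⊃ B) ∈ˡ Σ → A ∈ˡ Σ → B ∈ˡ Σ → Neg t (A ⊃ B) →
            Some S (λ u → t ⊑ u × Pos u A × Neg u B) ⊎ Inconsistent t
  check-⊃ {A} {B} {t} AB∈ A∈ B∈ n =
    Sum.map₂ inconsistent (some⊎every S λ u → ×⊎ (⊑⊎ t u) (×⊎ (pos⊎neg u A) (swap (pos⊎neg u B))))
    where
    inconsistent : Every S (λ u → Some Σ (λ C → Pos t C × Neg u C) ⊎ Neg u A ⊎ Pos u B) →
                   Inconsistent t
    inconsistent f {X} below above =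
      ≤-trans (curry (separate (λ v v∈S → case (f v v∈S)))) (above AB∈ n)
      where
      case : ∀ {v} → Some Σ (λ C → Pos t C × Neg v C) ⊎ Neg v A ⊎ Pos v B → Separated (X ⊓ A) B v
      case (inj₁ (C , C∈ , p , n)) = inj₁ (C , C∈ , ≤-trans ax-fst (below C∈ p) , n)
      case (inj₂ (inj₁ n))         = inj₁ (A , A∈ , ax-snd , n)
      case (inj₂ (inj₂ p))         = inj₂ (inj₁ (B , B∈ , ≤-refl , p))

  _⊏_ : Ty → Ty → Set
  u ⊏ v = u ⊑ v × Some Σ (λ A → Neg u A × Pos v A)

  -- When all proper extensions of `u` omitting `G` are inconsistent, `u` acts as a maximal type
  -- omitting `G`: a type with the true formulas of `u` and `A` but without `G` would be such an
  -- extension, `A` making it proper.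
  saturated : ∀ {u G} → G ∈ˡ Σ →
              (∀ {v} → v ∈ˡ S → u ⊏ v → Neg v G → Inconsistent v) →
              Below u X → A ∈ˡ Σ → Neg u A → X ⊓ A ≤ G
  saturated {X} {A} {u} {G} G∈ above below A∈ n = separate case
    where
    case : Every S (Separated (X ⊓ A) G)
    case v v∈S with ⊑⊎ u v | pos⊎neg v A | pos⊎neg v G
    ... | inj₂ (C , C∈ , p , n′) | _       | _       = inj₁ (C , C∈ , ≤-trans ax-fst (below C∈ p) , n′)
    ... | inj₁ _                 | inj₂ n′ | _       = inj₁ (A , A∈ , ax-snd , n′)
    ... | inj₁ _                 | inj₁ _  | inj₁ p′ = inj₂ (inj₁ (G , G∈ , ≤-refl , p′))
    ... | inj₁ u⊑v               | inj₁ p  | inj₂ n′ = inj₂ (inj₂ (above v∈S (u⊑v , A , A∈ , n , p) n′))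

  -- Well-founded induction replaces the choice of a maximal type omitting G.
  check-above : ∀ {t G} {Q : Ty → Set} → G ∈ˡ Σ → t ∈ˡ S → Neg t G →
    (∀ {u} → Neg u G →
      (∀ {X A} → Below u X → A ∈ˡ Σ → Neg u A → X ⊓ A ≤ G) → Q u → Inconsistent u) →
    Every S (λ u → Some Σ (λ A → Pos t A × Neg u A) ⊎ Q u) → Inconsistent t
  check-above {t} {G} {Q} G∈ t∈S n step q = go (ascending t) t∈S ⊑-refl n
    where
    go : ∀ {u} → Acc (λ v u → u ⊏ v) u → u ∈ˡ S → t ⊑ u → Neg u G → Inconsistent u
    go (acc rs) u∈S t⊑u n =
      step n (saturated G∈ λ v∈S u⊏v → go (rs u⊏v) v∈S (⊑-trans t⊑u (proj₁ u⊏v)))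
        -- A type above `t` keeps the true formulas of `t`, so only the alternative `Q` remains.
        ([ (λ (A , A∈ , p , n) → Empty-elim (disjoint (⊑-pos t⊑u A∈ p) n)) , id ]′ (q _ u∈S))

  dia-saturated : ∀ {u G} → (∀ {X A} → Below u X → A ∈ˡ Σ → Neg u A → X ⊓ A ≤ G) →
                  Below u X → X ⊓ dia (⋁ (un-dia u)) ≤ G
  dia-saturated {X} {u} sat below = app (app (const flipped) ax-snd) ax-fst
    where
    -- `dia-⋁` has no side context, so `X` is moved to the right before the disjuncts are treated
    -- one by one.
    flipped : ⊢ (dia (⋁ (un-dia u)) ⊃ (X ⊃ _))
    flipped = dia-⋁ (un-dia u) λ D∈ → let _ , ◇D∈Σ , n = un-dia⁻ D∈ in
      curry (≤-trans ⟨ ax-snd , ax-fst ⟩ (sat below ◇D∈Σ n))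

  -- If a saturated `u` has no suitable successor, every type in `S` compatible with `u` contains
  -- `C`, whence `X ≤ box (C ⊔ ⋁ (un-dia u))`. Saturation gives `X ⊓ dia (⋁ (un-dia u)) ≤ box C`,
  -- and `box-dia` removes the unwanted alternative.
  check-box : ∀ {t} → box C ∈ˡ Σ → C ∈ˡ Σ → t ∈ˡ S → Neg t (box C) →
              Some S (λ u → t ⊑ u × Some S (λ v → Compat u v × Neg v C)) ⊎ Inconsistent t
  check-box {C} {t} □C∈ C∈ t∈S n =
    Sum.map₂ (λ f → check-above □C∈ t∈S n step f)
      (some⊎every S λ u → ×⊎ (⊑⊎ t u) (some⊎every S λ v → ×⊎ (compat⊎ u v) (swap (pos⊎neg v C))))
    where
    step : ∀ {u} → Neg u (box C) →
           (∀ {X A} → Below u X → A ∈ˡ Σ → Neg u A → X ⊓ A ≤ box C) →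
           Every S (λ v → Clash u v ⊎ Pos v C) → Inconsistent u
    step {u} n sat f below above =
      ≤-trans (≤-trans ⟨ ≤-refl , ≤-trans (below-box below) (box-map covered) ⟩
                       (box-dia (dia-saturated sat below)))
              (above □C∈ n)
      where
      covered : ⋀ (un-box u) ≤ C ⊔ ⋁ (un-dia u)
      covered = separate λ v v∈S →
        [ clash-separated ≤-refl ⊔-inr , (λ p → inj₂ (inj₁ (C , C∈ , ⊔-inl , p))) ]′ (f v v∈S)

  -- Without such a `v`, the true `bdia C` can be weakened to `bdia (⋁ (un-dia t))`. This entails
  -- `dia (⋁ (un-dia t))`, which lies below `Y`.
  check-bdia⁺ : ∀ {t} → bdia C ∈ˡ Σ → C ∈ˡ Σ → Pos t (bdia C) →
                Some S (λ v → Compat t v × Pos v C) ⊎ Inconsistent t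
  check-bdia⁺ {C} {t} ⧫C∈ C∈ p =
    Sum.map₂ inconsistent (some⊎every S λ v → ×⊎ (compat⊎ t v) (pos⊎neg v C))
    where
    inconsistent : Every S (λ v → Clash t v ⊎ Neg v C) → Inconsistent t
    inconsistent f below above =
      ≤-trans (≤-trans (box-bdia-mono covered (below-box below) (below ⧫C∈ p)) bdia⇒dia) (above-dia above)
      where
      covered : ⋀ (un-box t) ⊓ C ≤ ⋁ (un-dia t)
      covered = separate λ v v∈S →
        [ clash-separated ax-fst ≤-refl , (λ n → inj₁ (C , C∈ , ax-snd , n)) ]′ (f v v∈S)

  Bad : List Ty → Ty → Set
  Bad L u = Some (un-bdia u) (λ D → Every L (λ v → Clash u v ⊎ Neg v D))
          ⊎ Some (un-bbox u) (λ D → Every L (λ v → Clash u v ⊎ Pos v D))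

  good⊎bad : ∀ L u → (GoodBdia L u × GoodBbox L u) ⊎ Bad L u
  good⊎bad L u = ×⊎
    (swap (some⊎every (un-bdia u) λ D → swap (some⊎every L λ v → ×⊎ (compat⊎ u v) (pos⊎neg v D))))
    (swap (some⊎every (un-bbox u) λ D → swap (some⊎every L λ v → ×⊎ (compat⊎ u v) (swap (pos⊎neg v D)))))

  -- To refute `bdia C`, some `u` above `t` must get by with successors omitting `C`; `L` contains
  -- all types of `S` that omit it. Failure at a saturated `u` is due to one demand for a witness
  -- that no compatible type in `L` meets.
  check-bdia⁻ : ∀ {t} L → Every S (λ v → v ∈ˡ L ⊎ Pos v C) →
                bdia C ∈ˡ Σ → C ∈ˡ Σ → t ∈ˡ S → Neg t (bdia C) →
                Some S (λ u → t ⊑ u × GoodBdia L u × GoodBbox L u) ⊎ Inconsistent t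
  check-bdia⁻ {C} {t} L L-spec ⧫C∈ C∈ t∈S n =
    Sum.map₂ (λ f → check-above ⧫C∈ t∈S n step f)
      (some⊎every S λ u → ×⊎ (⊑⊎ t u) (good⊎bad L u))
    where
    step : ∀ {u} → Neg u (bdia C) →
           (∀ {X A} → Below u X → A ∈ˡ Σ → Neg u A → X ⊓ A ≤ bdia C) →
           Bad L u → Inconsistent u
    -- A true `bdia D` without witness in `L` yields `bdia (⋁ (un-dia u) ⊔ C)`, and saturation cuts
    -- away the first alternative.
    step {u} n sat (inj₁ (D , D∈ , f)) below above =
      ≤-trans (bdia-cut (box-bdia-mono covered (below-box below) (below ⧫D∈Σ p)) (dia-saturated sat below))
              (above ⧫C∈ n)
      where
      D∈Σ = proj₁ (un-bdia⁻ D∈)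
      ⧫D∈Σ = proj₁ (proj₂ (un-bdia⁻ D∈))
      p = proj₂ (proj₂ (un-bdia⁻ D∈))
      case : ∀ {v} → (v ∈ˡ L ⊎ Pos v C) → Separated (⋀ (un-box u) ⊓ D) (⋁ (un-dia u) ⊔ C) v
      case (inj₂ p) = inj₂ (inj₁ (C , C∈ , ⊔-inr , p))
      case (inj₁ v∈L) = [ clash-separated ax-fst ⊔-inl , (λ n → inj₁ (D , D∈Σ , ax-snd , n)) ]′ (f _ v∈L)
      covered : ⋀ (un-box u) ⊓ D ≤ ⋁ (un-dia u) ⊔ C
      covered = separate (λ v v∈S → case (L-spec v v∈S))
    -- For a false `bbox D` without witness in `L`, saturation leads from `bbox D` to `bdia C`, so
    -- `bbox-cut` yields the same `bdia (⋁ (un-dia u) ⊔ C)`.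
    step {u} n sat (inj₂ (D , D∈ , f)) below above =
      ≤-trans (bdia-cut (bbox-cut covered (below-box below)
                          (≤-trans (sat below ■D∈Σ n′) (bdia-map ⊔-inr)))
                        (dia-saturated sat below))
              (above ⧫C∈ n)
      where
      D∈Σ = proj₁ (un-bbox⁻ D∈)
      ■D∈Σ = proj₁ (proj₂ (un-bbox⁻ D∈))
      n′ = proj₂ (proj₂ (un-bbox⁻ D∈))
      case : ∀ {v} → (v ∈ˡ L ⊎ Pos v C) → Separated (⋀ (un-box u)) (D ⊔ (⋁ (un-dia u) ⊔ C)) v
      case (inj₂ p) = inj₂ (inj₁ (C , C∈ , ≤-trans ⊔-inr ⊔-inr , p))
      case (inj₁ v∈L) =
        [ clash-separated ≤-refl (≤-trans ⊔-inl ⊔-inr) , (λ p → inj₂ (inj₁ (D , D∈Σ , ⊔-inl , p))) ]′ (f _ v∈L)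
      covered : ⋀ (un-box u) ≤ D ⊔ (⋁ (un-dia u) ⊔ C)
      covered = separate (λ v v∈S → case (L-spec v v∈S))

  check-𝟙 : ∀ {t} → 𝟙 ∈ˡ Σ → Neg t 𝟙 → Inconsistent t
  check-𝟙 𝟙∈ n below above = ≤-trans (const ax-𝟙) (above 𝟙∈ n)

  check-⊃⁺ : ∀ {t} → (A ⊃ B) ∈ˡ Σ → A ∈ˡ Σ → B ∈ˡ Σ → Pos t (A ⊃ B) →
             (Neg t A ⊎ Pos t B) ⊎ Inconsistent t
  check-⊃⁺ {A} {B} {t} AB∈ A∈ B∈ p with pos⊎neg t A | pos⊎neg t B
  ... | inj₂ n  | _       = inj₁ (inj₁ n)
  ... | inj₁ _  | inj₁ p′ = inj₁ (inj₂ p′)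
  ... | inj₁ p′ | inj₂ n  = inj₂ λ below above → ≤-trans (app (below AB∈ p) (below A∈ p′)) (above B∈ n)

  check-⊓⁺ : ∀ {t} → (A ⊓ B) ∈ˡ Σ → A ∈ˡ Σ → B ∈ˡ Σ → Pos t (A ⊓ B) →
             (Pos t A × Pos t B) ⊎ Inconsistent t
  check-⊓⁺ {A} {B} {t} AB∈ A∈ B∈ p with ×⊎ (pos⊎neg t A) (pos⊎neg t B)
  ... | inj₁ ok       = inj₁ ok
  ... | inj₂ (inj₁ n) = inj₂ λ below above → ≤-trans (≤-trans (below AB∈ p) ax-fst) (above A∈ n)
  ... | inj₂ (inj₂ n) = inj₂ λ below above → ≤-trans (≤-trans (below AB∈ p) ax-snd) (above B∈ n)

  check-⊓⁻ : ∀ {t} → (A ⊓ B) ∈ˡ Σ → A ∈ˡ Σ → B ∈ˡ Σ → Neg t (A ⊓ B) →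
             (Neg t A ⊎ Neg t B) ⊎ Inconsistent t
  check-⊓⁻ {A} {B} {t} AB∈ A∈ B∈ n with ×⊎ (pos⊎neg t A) (pos⊎neg t B)
  ... | inj₂ ok       = inj₁ ok
  ... | inj₁ (p , p′) = inj₂ λ below above → ≤-trans ⟨ below A∈ p , below B∈ p′ ⟩ (above AB∈ n)

-- Types over a finite set of formulas

-- A formula is determined by its outermost connective, its two immediate
-- subformulas and its atom, with junk values where these do not exist.
tag : Fo → ℕ
tag (at _)  = 0
tag (_ ⇀ _) = 1
tag (_ ↽ _) = 2
tag (_ ∨ _) = 3
tag (_ ∧ _) = 4
tag ⊤       = 5
tag ⊥       = 6
tag (◇ _)   = 7
tag (□ _)   = 8
tag (⧫ _)   = 9
tag (■ _)   = 10

left right : Fo → Fo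
left (A ⇀ _) = A
left (A ↽ _) = A
left (A ∨ _) = A
left (A ∧ _) = A
left (◇ A)   = A
left (□ A)   = A
left (⧫ A)   = A
left (■ A)   = A
left A       = A
right (_ ⇀ B) = B
right (_ ↽ B) = B
right (_ ∨ B) = B
right (_ ∧ B) = B
right A       = A

atom : Fo → At
atom (at p) = p
atom _      = 0

build : ℕ → At → Fo → Fo → Fo
build 0 p A B = at p
build 1 p A B = A ⇀ B
build 2 p A B = A ↽ B
build 3 p A B = A ∨ B
build 4 p A B = A ∧ B
build 5 p A B = ⊤
build 6 p A B = ⊥
build 7 p A B = ◇ A
build 8 p A B = □ A
build 9 p A B = ⧫ A
build _ p A B = ■ A

build-tag : ∀ A → build (tag A) (atom A) (left A) (right A) ≡ A
build-tag (at _)  = refl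
build-tag (_ ⇀ _) = refl
build-tag (_ ↽ _) = refl
build-tag (_ ∨ _) = refl
build-tag (_ ∧ _) = refl
build-tag ⊤       = refl
build-tag ⊥       = refl
build-tag (◇ _)   = refl
build-tag (□ _)   = refl
build-tag (⧫ _)   = refl
build-tag (■ _)   = refl

rebuild : ∀ C {n p A B} → n ≡ tag C → p ≡ atom C → A ≡ left C → B ≡ right C → build n p A B ≡ C
rebuild C refl refl refl refl = build-tag C

infix 4 _≟_
_≟_ : DecidableEquality Fo
at p ≟ C = map′ (λ (n , p) → rebuild C n p refl refl) (λ { refl → refl , refl })
             ((0 ≟ⁿ tag C) ×-dec (p ≟ⁿ atom C))
A ⇀ B ≟ C = map′ (λ (n , l , r) → rebuild C n refl l r) (λ { refl → refl , refl , refl })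
             ((1 ≟ⁿ tag C) ×-dec (A ≟ left C) ×-dec (B ≟ right C))
A ↽ B ≟ C = map′ (λ (n , l , r) → rebuild C n refl l r) (λ { refl → refl , refl , refl })
             ((2 ≟ⁿ tag C) ×-dec (A ≟ left C) ×-dec (B ≟ right C))
A ∨ B ≟ C = map′ (λ (n , l , r) → rebuild C n refl l r) (λ { refl → refl , refl , refl })
             ((3 ≟ⁿ tag C) ×-dec (A ≟ left C) ×-dec (B ≟ right C))
A ∧ B ≟ C = map′ (λ (n , l , r) → rebuild C n refl l r) (λ { refl → refl , refl , refl })
             ((4 ≟ⁿ tag C) ×-dec (A ≟ left C) ×-dec (B ≟ right C))
⊤ ≟ C = map′ (λ n → rebuild C n refl refl refl) (λ { refl → refl }) (5 ≟ⁿ tag C)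
⊥ ≟ C = map′ (λ n → rebuild C n refl refl refl) (λ { refl → refl }) (6 ≟ⁿ tag C)
◇ A ≟ C = map′ (λ (n , l) → rebuild C n refl l refl) (λ { refl → refl , refl })
            ((7 ≟ⁿ tag C) ×-dec (A ≟ left C))
□ A ≟ C = map′ (λ (n , l) → rebuild C n refl l refl) (λ { refl → refl , refl })
            ((8 ≟ⁿ tag C) ×-dec (A ≟ left C))
⧫ A ≟ C = map′ (λ (n , l) → rebuild C n refl l refl) (λ { refl → refl , refl })
            ((9 ≟ⁿ tag C) ×-dec (A ≟ left C))
■ A ≟ C = map′ (λ (n , l) → rebuild C n refl l refl) (λ { refl → refl , refl })
            ((10 ≟ⁿ tag C) ×-dec (A ≟ left C))

-- Subformulas

subformulas proper : Fo → List Fo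
subformulas A = A ∷ proper A
proper (at _)  = []
proper (A ⇀ B) = subformulas A ++ subformulas B
proper (A ↽ B) = subformulas A ++ subformulas B
proper (A ∨ B) = subformulas A ++ subformulas B
proper (A ∧ B) = subformulas A ++ subformulas B
proper ⊤       = []
proper ⊥       = []
proper (◇ A)   = subformulas A
proper (□ A)   = subformulas A
proper (⧫ A)   = subformulas A
proper (■ A)   = subformulas A

subformulas-trans : ∀ A → B ∈ˡ subformulas A → (subformulas B) ⊆ˡ (subformulas A)
proper-trans      : ∀ A → B ∈ˡ proper A → (subformulas B) ⊆ˡ (proper A)
subformulas-trans A (here refl) = id
subformulas-trans A (there B∈)  = there ∘ proper-trans A B∈

++-trans : ∀ A₁ A₂ → B ∈ˡ subformulas A₁ ++ subformulas A₂ →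
           (subformulas B) ⊆ˡ (subformulas A₁ ++ subformulas A₂)
++-trans A₁ A₂ B∈ with ∈-++⁻ (subformulas A₁) B∈
... | inj₁ B∈₁ = ∈-++⁺ˡ ∘ subformulas-trans A₁ B∈₁
... | inj₂ B∈₂ = ∈-++⁺ʳ (subformulas A₁) ∘ subformulas-trans A₂ B∈₂

proper-trans (A₁ ⇀ A₂) = ++-trans A₁ A₂
proper-trans (A₁ ↽ A₂) = ++-trans A₁ A₂
proper-trans (A₁ ∨ A₂) = ++-trans A₁ A₂
proper-trans (A₁ ∧ A₂) = ++-trans A₁ A₂
proper-trans (◇ A)     = subformulas-trans A
proper-trans (□ A)     = subformulas-trans A
proper-trans (⧫ A)     = subformulas-trans A
proper-trans (■ A)     = subformulas-trans A

-- A termination measure on types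

count : (Fo → Bool) → List Fo → ℕ
count f []      = 0
count f (A ∷ l) = if f A then suc (count f l) else count f l

count-mono : ∀ {f g} l → (∀ A → A ∈ˡ l → f A ≡ true → g A ≡ true) → count f l ≤ⁿ count g l
count-mono []      h = ≤ⁿ-refl
count-mono {f} {g} (A ∷ l) h with f A in fA | g A in gA | count-mono {f} {g} l (λ B → h B ∘ there)
... | true  | true  | ih = s≤s ih
... | false | true  | ih = m≤n⇒m≤1+n ih
... | false | false | ih = ih
... | true  | false | ih with () ← trans (sym gA) (h A (here refl) fA)

count-strict : ∀ {f g} l → (∀ A → A ∈ˡ l → f A ≡ true → g A ≡ true) →
               ∀ {A} → A ∈ˡ l → f A ≡ false → g A ≡ true → count f l < count g l
count-strict {f} {g} (A ∷ l) h (here refl) fA gA rewrite fA | gA =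
  s≤s (count-mono l (λ B → h B ∘ there))
count-strict {f} {g} (B ∷ l) h (there A∈) fA gA
  with f B in fB | g B in gB | count-strict {f} {g} l (λ B → h B ∘ there) A∈ fA gA
... | true  | true  | ih = s≤s ih
... | false | true  | ih = m≤n⇒m≤1+n ih
... | false | false | ih = ih
... | true  | false | ih with () ← trans (sym gB) (h B (here refl) fB)

true⊎false : ∀ b → b ≡ true ⊎ b ≡ false
true⊎false true  = inj₁ refl
true⊎false false = inj₂ refl

true≢false : b ≡ true → b ≡ false → Empty
true≢false refl ()

module _ (Σ : List Fo) where
  open DecMembership _≟_ using (_∈?_)

  infix 4 _⊑_
  _⊑_ Compatible : Ty → Ty → Set

  -- Membership of `f A` in `Σ` is tested because `u (f A)` is meaningless outside `Σ`.
  preimage : (Fo → Fo) → Bool → Ty → List Fo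
  preimage f b u = filter (λ A → (f A ∈? Σ) ×-dec (u (f A) ≟ᵇ b)) Σ

  u ⊑ v = Every Σ (λ A → u A ≡ true → v A ≡ true)

  Compatible u v = Every (preimage □_ true u) (λ A → v A ≡ true)
                 × Every (preimage ◇_ false u) (λ A → v A ≡ false)

  ∈-preimage⁺ : ∀ {f} u → A ∈ˡ Σ → f A ∈ˡ Σ → u (f A) ≡ b → A ∈ˡ preimage f b u
  ∈-preimage⁺ u A∈ fA∈ e = ∈-filter⁺ _ A∈ (fA∈ , e)

  ∈-preimage⁻ : ∀ {f} u → A ∈ˡ preimage f b u → A ∈ˡ Σ × f A ∈ˡ Σ × u (f A) ≡ b
  ∈-preimage⁻ {b = b} {f} u A∈ = ∈-filter⁻ (λ A → (f A ∈? Σ) ×-dec (u (f A) ≟ᵇ b)) A∈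

  ⊑-false : ∀ {u v} → u ⊑ v → A ∈ˡ Σ → v A ≡ false → u A ≡ false
  ⊑-false {A} {u} u⊑v A∈ n =
    [ (λ p → Empty-elim (true≢false (u⊑v A A∈ p) n)) , id ]′ (true⊎false (u A))

  ⊑-dichotomy : ∀ u v → u ⊑ v ⊎ Some Σ (λ A → u A ≡ true × v A ≡ false)
  ⊑-dichotomy u v = swap (Sum.map₂ (λ f A A∈ p → [ (λ n → Empty-elim (true≢false p n)) , id ]′ (f A A∈))
    (some⊎every Σ λ A → Sum.map₂ [ inj₁ , inj₂ ]′ (×⊎ (true⊎false (u A)) (swap (true⊎false (v A))))))

  ascending : WellFounded (λ v u → u ⊑ v × Some Σ (λ A → u A ≡ false × v A ≡ true))
  ascending = Subrelation.wellFounded decrease (On.wellFounded (λ u → count (not ∘ u) Σ) <-wellFounded)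
    where
    decrease : ∀ {v u} → u ⊑ v × Some Σ (λ A → u A ≡ false × v A ≡ true) →
               count (not ∘ v) Σ < count (not ∘ u) Σ
    decrease {v} {u} (u⊑v , A , A∈ , n , p) =
      count-strict Σ (λ B B∈ nv → cong not (⊑-false u⊑v B∈ (not-true nv))) A∈ (cong not p) (cong not n)
      where
      not-true : ∀ {b} → not b ≡ true → b ≡ false
      not-true {false} _ = refl

  descending : WellFounded (λ v u → v ⊑ u × Some Σ (λ A → u A ≡ true × v A ≡ false))
  descending = Subrelation.wellFounded
    (λ (v⊑u , A , A∈ , p , n) → count-strict Σ v⊑u A∈ n p)
    (On.wellFounded (λ u → count u Σ) <-wellFounded)

  setting : List Ty → Setting
  setting S = record
    { logic = Lmin-logic ; Σ = Σ ; S = S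
    ; Pos = λ u A → u A ≡ true ; Neg = λ u A → u A ≡ false
    ; pos⊎neg = λ u A → true⊎false (u A) ; disjoint = true≢false
    ; un-box = preimage □_ true ; un-dia = preimage ◇_ false
    ; un-bdia = preimage ⧫_ true ; un-bbox = preimage ■_ false
    ; un-box⁻ = λ {_} {u} → ∈-preimage⁻ u
    ; un-dia⁻ = λ {_} {u} → ∈-preimage⁻ u
    ; un-bdia⁻ = λ {_} {u} → ∈-preimage⁻ u
    ; un-bbox⁻ = λ {_} {u} → ∈-preimage⁻ u
    ; _⊑_ = _⊑_ ; ⊑-pos = λ u⊑v A∈ → u⊑v _ A∈ ; ⊑-neg = λ {_} {u} u⊑v A∈ → ⊑-false {u = u} u⊑v A∈
    ; ⊑-refl = λ _ _ → id ; ⊑-trans = λ u⊑v v⊑w A A∈ → v⊑w A A∈ ∘ u⊑v A A∈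
    ; ⊑⊎ = ⊑-dichotomy
    ; Compat = Compatible
    ; compat⊎ = λ u v → ×⊎
        (swap (some⊎every _ λ A → swap (true⊎false (v A))))
        (swap (some⊎every _ λ A → true⊎false (v A)))
    ; ascending = ascending ; descending = descending
    }

  Good : List Ty → Ty → Set
  Good L u = Every (preimage ⧫_ true u) (λ D → Some L (λ v → Compatible u v × v D ≡ true))
           × Every (preimage ■_ false u) (λ D → Some L (λ v → Compatible u v × v D ≡ false))

  -- Realised types and the elimination of the others

  restrict : Bool → Fo → List Ty → List Ty
  restrict b A = filter (λ u → u A ≟ᵇ b)

  -- `Unit` marks formulas that ask for nothing beyond the valuation, `_⊑_`, `Compatible` and
  -- `Good`. For a false `⧫ A` and a true `■ A` the witness is a type that is good even when its
  -- successors are restricted to types omitting, respectively containing, `A`.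
  Realised⁺ Realised⁻ : List Ty → Ty → Fo → Set
  Realised⁺ S t (at _)  = Unit
  Realised⁺ S t (A ⇀ B) = t A ≡ false ⊎ t B ≡ true
  Realised⁺ S t (A ↽ B) = Some S λ u → u ⊑ t × u A ≡ false × u B ≡ true
  Realised⁺ S t (A ∨ B) = t A ≡ true ⊎ t B ≡ true
  Realised⁺ S t (A ∧ B) = t A ≡ true × t B ≡ true
  Realised⁺ S t ⊤       = Unit
  Realised⁺ S t ⊥       = Empty
  Realised⁺ S t (◇ A)   = Some S λ u → u ⊑ t × Some S λ v → Compatible u v × v A ≡ true
  Realised⁺ S t (□ A)   = Unit
  Realised⁺ S t (⧫ A)   = Unit
  Realised⁺ S t (■ A)   = Some S λ u → u ⊑ t × Good (restrict true A S) u
  Realised⁻ S t (at _)  = Unit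
  Realised⁻ S t (A ⇀ B) = Some S λ u → t ⊑ u × u A ≡ true × u B ≡ false
  Realised⁻ S t (A ↽ B) = t A ≡ true ⊎ t B ≡ false
  Realised⁻ S t (A ∨ B) = t A ≡ false × t B ≡ false
  Realised⁻ S t (A ∧ B) = t A ≡ false ⊎ t B ≡ false
  Realised⁻ S t ⊤       = Empty
  Realised⁻ S t ⊥       = Unit
  Realised⁻ S t (◇ A)   = Unit
  Realised⁻ S t (□ A)   = Some S λ u → t ⊑ u × Some S λ v → Compatible u v × v A ≡ false
  Realised⁻ S t (⧫ A)   = Some S λ u → t ⊑ u × Good (restrict false A S) u
  Realised⁻ S t (■ A)   = Unit

  Realised : List Ty → Ty → Set
  Realised S t = Every Σ (λ A → (t A ≡ true → Realised⁺ S t A) × (t A ≡ false → Realised⁻ S t A))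
               × Good S t

  Closed : Set
  Closed = Every Σ (λ A → (subformulas A) ⊆ˡ Σ)

  module _ (closed : Closed) where
    unary : (B : Fo) → B ∈ˡ Σ → proper B ≡ subformulas A → A ∈ˡ Σ
    unary B B∈ eq = closed B B∈ (there (subst (_ ∈ˡ_) (sym eq) (here refl)))

    binary : (C : Fo) → C ∈ˡ Σ → proper C ≡ subformulas A ++ subformulas B → A ∈ˡ Σ × B ∈ˡ Σ
    binary {A} C C∈ eq =
      closed C C∈ (there (subst (_ ∈ˡ_) (sym eq) (here refl))) ,
      closed C C∈ (there (subst (_ ∈ˡ_) (sym eq) (∈-++⁺ʳ (subformulas A) (here refl))))

    module _ (S : List Ty) (covering : Setting.Covering (setting S)) where
      open Setting (setting S) using (Inconsistent)
      open Dual (setting S)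
      private
        module E = Elimination (setting S) covering
        module E′ = Elimination (dualSetting (setting S)) (covering-dual covering)

      dual⊎ : ∀ {t} {P : Set} → P ⊎ Setting.Inconsistent (dualSetting (setting S)) t → P ⊎ Inconsistent t
      dual⊎ = Sum.map₂ inconsistent-dual

      restrict-spec : ∀ b A → Every S (λ u → u ∈ˡ restrict b A S ⊎ u A ≡ not b)
      restrict-spec true  A u u∈ = Sum.map₁ (∈-filter⁺ _ u∈) (true⊎false (u A))
      restrict-spec false A u u∈ = Sum.map₁ (∈-filter⁺ _ u∈) (swap (true⊎false (u A)))

      check⁺ : ∀ {t} → t ∈ˡ S → ∀ A → A ∈ˡ Σ → t A ≡ true → Realised⁺ S t A ⊎ Inconsistent t
      check⁺ t∈ (at _)    A∈ p = inj₁ tt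
      check⁺ t∈ C@(A ⇀ B) C∈ p = let A∈ , B∈ = binary C C∈ refl in E.check-⊃⁺ C∈ A∈ B∈ p
      check⁺ t∈ C@(A ↽ B) C∈ p = let A∈ , B∈ = binary C C∈ refl in dual⊎ (E′.check-⊃ C∈ A∈ B∈ p)
      check⁺ t∈ C@(A ∨ B) C∈ p = let A∈ , B∈ = binary C C∈ refl in dual⊎ (E′.check-⊓⁻ C∈ A∈ B∈ p)
      check⁺ t∈ C@(A ∧ B) C∈ p = let A∈ , B∈ = binary C C∈ refl in E.check-⊓⁺ C∈ A∈ B∈ p
      check⁺ t∈ ⊤         C∈ p = inj₁ tt
      check⁺ t∈ ⊥         C∈ p = inj₂ (inconsistent-dual (E′.check-𝟙 C∈ p))
      check⁺ t∈ C@(◇ A)   C∈ p = dual⊎ (E′.check-box C∈ (unary C C∈ refl) t∈ p)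
      check⁺ t∈ (□ A)     C∈ p = inj₁ tt
      check⁺ t∈ (⧫ A)     C∈ p = inj₁ tt
      -- The dual setting lists the two halves of `Good` in the opposite order.
      check⁺ t∈ C@(■ A)   C∈ p = Sum.map₁ (λ (u , u∈ , u⊑t , g , g′) → u , u∈ , u⊑t , g′ , g)
        (dual⊎ (E′.check-bdia⁻ (restrict true A S) (restrict-spec true A) C∈ (unary C C∈ refl) t∈ p))

      check⁻ : ∀ {t} → t ∈ˡ S → ∀ A → A ∈ˡ Σ → t A ≡ false → Realised⁻ S t A ⊎ Inconsistent t
      check⁻ t∈ (at _)    C∈ n = inj₁ tt
      check⁻ t∈ C@(A ⇀ B) C∈ n = let A∈ , B∈ = binary C C∈ refl in E.check-⊃ C∈ A∈ B∈ n
      check⁻ t∈ C@(A ↽ B) C∈ n = let A∈ , B∈ = binary C C∈ refl in dual⊎ (E′.check-⊃⁺ C∈ A∈ B∈ n)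
      check⁻ t∈ C@(A ∨ B) C∈ n = let A∈ , B∈ = binary C C∈ refl in dual⊎ (E′.check-⊓⁺ C∈ A∈ B∈ n)
      check⁻ t∈ C@(A ∧ B) C∈ n = let A∈ , B∈ = binary C C∈ refl in E.check-⊓⁻ C∈ A∈ B∈ n
      check⁻ t∈ ⊤         C∈ n = inj₂ (E.check-𝟙 C∈ n)
      check⁻ t∈ ⊥         C∈ n = inj₁ tt
      check⁻ t∈ (◇ A)     C∈ n = inj₁ tt
      check⁻ t∈ C@(□ A)   C∈ n = E.check-box C∈ (unary C C∈ refl) t∈ n
      check⁻ t∈ C@(⧫ A)   C∈ n =
        E.check-bdia⁻ (restrict false A S) (restrict-spec false A) C∈ (unary C C∈ refl) t∈ n
      check⁻ t∈ (■ A)     C∈ n = inj₁ tt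

      check : ∀ t → t ∈ˡ S → Realised S t ⊎ Inconsistent t
      check t t∈ = Sum.map₂ [ id , [ id , id ]′ ]′ (×⊎
        (every⊎ Σ λ A A∈ → check-sign A A∈ (t A) refl)
        (×⊎ (every⊎ _ λ D D∈ → let D∈Σ , ⧫D∈Σ , p = ∈-preimage⁻ t D∈ in E.check-bdia⁺ ⧫D∈Σ D∈Σ p)
            (every⊎ _ λ D D∈ → let D∈Σ , ■D∈Σ , n = ∈-preimage⁻ t D∈ in dual⊎ (E′.check-bdia⁺ ■D∈Σ D∈Σ n))))
        where
        check-sign : ∀ A → A ∈ˡ Σ → ∀ b → t A ≡ b →
          ((t A ≡ true → Realised⁺ S t A) × (t A ≡ false → Realised⁻ S t A)) ⊎ Inconsistent t
        check-sign A A∈ true  p =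
          Sum.map₁ (λ r → (λ _ → r) , λ n → Empty-elim (true≢false p n)) (check⁺ t∈ A A∈ p)
        check-sign A A∈ false n =
          Sum.map₁ (λ r → (λ p → Empty-elim (true≢false p n)) , λ _ → r) (check⁻ t∈ A A∈ n)

    open Setting using (Covering; Relative)

    -- `Realised` depends on the current list, so each removal is followed by a fresh check of all
    -- types. The invariant survives because `Relative` is automatic for an inconsistent type.
    eliminate : ∀ S → Acc _<_ (length S) → Covering (setting S) →
                ∃ λ S′ → Covering (setting S′) × Every S′ (Realised S′)
    eliminate S (acc rs) covering
      with every⊎ S (λ t t∈ → Sum.map₂ (λ i → t , t∈ , i) (check S covering t t∈))
    ... | inj₁ ok = S , covering , ok
    ... | inj₂ (t , t∈ , i) with ∈-∃++ t∈
    ...   | S₁ , S₂ , refl = eliminate (S₁ ++ S₂) (rs shorter) covering′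
      where
      shorter : length (S₁ ++ S₂) < length (S₁ ++ t ∷ S₂)
      shorter rewrite length-++ S₁ {S₂} | length-++ S₁ {t ∷ S₂} =
        ≤-reflexive (sym (+-suc (length S₁) (length S₂)))
      covering′ : Covering (setting (S₁ ++ S₂))
      covering′ {X} {Y} f = covering λ u∈ X≤ ≤Y below above → case (∈-++⁻ S₁ u∈) X≤ ≤Y below above
        where
        case : ∀ {u} → u ∈ˡ S₁ ⊎ u ∈ˡ t ∷ S₂ → Relative (setting (S₁ ++ S₂)) u X Y
        case (inj₁ u∈)           X≤ ≤Y below above = f (∈-++⁺ˡ u∈) X≤ ≤Y below above
        case (inj₂ (here refl))  X≤ ≤Y below above = i below above
        case (inj₂ (there u∈))   X≤ ≤Y below above = f (∈-++⁺ʳ S₁ u∈) X≤ ≤Y below above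

-- The list of all types

update : Fo → Bool → Ty → Ty
update A b u B = if does (A ≟ B) then b else u B

types : List Fo → List Ty
types []      = (λ _ → true) ∷ []
types (A ∷ l) = map (update A true) (types l) ++ map (update A false) (types l)

update-elim : ∀ (P : Fo → Set) {c l u} → (b ≡ c → P A) → (∀ {B} → B ∈ˡ l → u B ≡ c → P B) →
              ∀ {B} → B ∈ˡ A ∷ l → update A b u B ≡ c → P B
update-elim {A = A} P here-case there-case {B} B∈ e with A ≟ B | B∈
... | yes refl | _          = here-case e
... | no  A≢B  | here refl  = Empty-elim (A≢B refl)
... | no  _    | there B∈l  = there-case B∈l e

types-covering : ∀ l → Setting.Covering (setting l (types l))
types-covering []      f = f (here refl) ≤-refl ≤-refl (λ ()) (λ ())
  where open LogicProperties Lmin-logic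
types-covering (A ∷ l) f = types-covering l λ {u} u∈ {X} {Y} X≤ ≤Y below above → cut
  (f (∈-++⁺ʳ (map (update A true) (types l)) (∈-map⁺ (update A false) u∈)) X≤ (≤-trans ≤Y ⊔-inl)
    (update-elim (X ≤_) (λ ()) below)
    (update-elim (_≤ (Y ⊔ A)) (λ _ → ⊔-inr) (λ B∈ n → ≤-trans (above B∈ n) ⊔-inl)))
  (f (∈-++⁺ˡ (∈-map⁺ (update A true) u∈)) (≤-trans ax-fst X≤) ≤Y
    (update-elim ((X ⊓ A) ≤_) (λ _ → ax-snd) (λ B∈ p → ≤-trans ax-fst (below B∈ p)))
    (update-elim (_≤ Y) (λ ()) above))
  where open LogicProperties Lmin-logic

-- The countermodel

module Countermodel (Σ : List Fo) (closed : Closed Σ) (S : List Ty)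
                    (realised : Every S (Realised Σ S)) where
  -- A type can occur with several successor lists: all of S for the sake of
  -- ⧫⁺ and ■⁻, and only the types omitting A (containing A) in order to
  -- refute ⧫ A (to satisfy ■ A).
  record World : Set where
    constructor world
    field
      ty         : Ty
      successors : List Ty
      included   : ∀ v → v ∈ˡ successors → v ∈ˡ S
      ty∈S       : ty ∈ˡ S
      good       : Good Σ successors ty
  open World

  unrestricted : ∀ u → u ∈ˡ S → World
  unrestricted u u∈ = world u S (λ _ → id) u∈ (proj₂ (realised u u∈))

  restricted : ∀ b A u → u ∈ˡ S → Good Σ (restrict Σ b A S) u → World
  restricted b A u u∈ g = world u (restrict Σ b A S) (λ v → proj₁ ∘ ∈-filter⁻ (λ u → u A ≟ᵇ b)) u∈ g

  frame : Frame
  frame = record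
    { W = World
    ; _≤_ = λ w w′ → _⊑_ Σ (ty w) (ty w′)
    ; ≤-refl = λ _ _ → id
    ; ≤-trans = λ u⊑v v⊑w A A∈ → v⊑w A A∈ ∘ u⊑v A A∈
    ; R = λ w w′ → ty w′ ∈ˡ successors w × Compatible Σ (ty w) (ty w′)
    }
  open Semantics frame
  open DecMembership _≟_ using (_∈?_)

  -- Atoms outside `Σ` are false everywhere, because `_⊑_` does not control the values there and
  -- persistence must hold.
  V : At → Pred World 0ℓ
  V p w = at p ∈ˡ Σ × ty w (at p) ≡ true

  V-isValuation : IsValuation V
  V-isValuation = record
    { stable     = λ p {w} → decidable-stable ((at p ∈? Σ) ×-dec (ty w (at p) ≟ᵇ true))
    ; persistent = λ p w≤u (p∈ , e) → p∈ , w≤u (at p) p∈ e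
    }

  -- Both signs are proved together, as `⇀` and `↽` mix them. Witnesses become worlds with all of
  -- `S` as successors, except for a true `■ A` and a false `⧫ A`.
  truth⁺ : ∀ A → A ∈ˡ Σ → ∀ w → ty w A ≡ true → Sat V A w
  truth⁻ : ∀ A → A ∈ˡ Σ → ∀ w → ty w A ≡ false → ¬ Sat V A w

  realised⁺ : ∀ A → A ∈ˡ Σ → ∀ w → ty w A ≡ true → Realised⁺ Σ S (ty w) A
  realised⁺ A A∈ w = proj₁ (proj₁ (realised (ty w) (ty∈S w)) A A∈)

  realised⁻ : ∀ A → A ∈ˡ Σ → ∀ w → ty w A ≡ false → Realised⁻ Σ S (ty w) A
  realised⁻ A A∈ w = proj₂ (proj₁ (realised (ty w) (ty∈S w)) A A∈)

  truth⁺ (at _)    A∈ w p = A∈ , p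
  truth⁺ C@(A ⇀ B) C∈ w p {u} w≤u a =
    let A∈ , B∈ = binary Σ closed C C∈ refl in
    [ (λ n → Empty-elim (truth⁻ A A∈ u n a)) , truth⁺ B B∈ u ]′ (realised⁺ C C∈ u (w≤u C C∈ p))
  truth⁺ C@(A ↽ B) C∈ w p f =
    let A∈ , B∈ = binary Σ closed C C∈ refl
        u , u∈ , u⊑w , n , p′ = realised⁺ C C∈ w p
        w′ = unrestricted u u∈ in
    truth⁻ A A∈ w′ n (f {w′} u⊑w (truth⁺ B B∈ w′ p′))
  truth⁺ C@(A ∨ B) C∈ w p (¬a , ¬b) =
    let A∈ , B∈ = binary Σ closed C C∈ refl in
    [ ¬a ∘ truth⁺ A A∈ w , ¬b ∘ truth⁺ B B∈ w ]′ (realised⁺ C C∈ w p)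
  truth⁺ C@(A ∧ B) C∈ w p =
    let A∈ , B∈ = binary Σ closed C C∈ refl
        p₁ , p₂ = realised⁺ C C∈ w p in
    truth⁺ A A∈ w p₁ , truth⁺ B B∈ w p₂
  truth⁺ ⊤         C∈ w p = tt
  truth⁺ ⊥         C∈ w p = realised⁺ ⊥ C∈ w p
  truth⁺ C@(◇ A)   C∈ w p f =
    let A∈ = unary Σ closed C C∈ refl
        u , u∈ , u⊑w , v , v∈ , c , p′ = realised⁺ C C∈ w p
        v′ = unrestricted v v∈ in
    f {unrestricted u u∈} {v′} u⊑w (v∈ , c) (truth⁺ A A∈ v′ p′)
  truth⁺ C@(□ A)   C∈ w p {u} {v} w≤u (_ , c , _) =
    let A∈ = unary Σ closed C C∈ refl in
    truth⁺ A A∈ v (c A (∈-preimage⁺ Σ (ty u) A∈ C∈ (w≤u C C∈ p)))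
  truth⁺ C@(⧫ A)   C∈ w p {u} w≤u f =
    let A∈ = unary Σ closed C C∈ refl
        -- The successor lists of `w` and `u` may differ, so the witness comes from the field `good`
        -- of `u`.
        v , v∈ , c , p′ = proj₁ (good u) A (∈-preimage⁺ Σ (ty u) A∈ C∈ (w≤u C C∈ p))
        v′ = unrestricted v (included u v v∈) in
    f {v′} (v∈ , c) (truth⁺ A A∈ v′ p′)
  truth⁺ C@(■ A)   C∈ w p f =
    let A∈ = unary Σ closed C C∈ refl
        u , u∈ , u⊑w , g = realised⁺ C C∈ w p in
    -- Every type in the restricted list contains `A`, compatible or not.
    f {restricted true A u u∈ g} u⊑w λ {v} (v∈ , _) →
      truth⁺ A A∈ v (proj₂ (∈-filter⁻ (λ u → u A ≟ᵇ true) {xs = S} v∈))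

  truth⁻ (at _)    A∈ w n (_ , p) = true≢false p n
  truth⁻ C@(A ⇀ B) C∈ w n f =
    let A∈ , B∈ = binary Σ closed C C∈ refl
        u , u∈ , w⊑u , p , n′ = realised⁻ C C∈ w n
        w′ = unrestricted u u∈ in
    truth⁻ B B∈ w′ n′ (f {w′} w⊑u (truth⁺ A A∈ w′ p))
  truth⁻ C@(A ↽ B) C∈ w n e =
    let A∈ , B∈ = binary Σ closed C C∈ refl in
    e λ {u} u≤w b → [ truth⁺ A A∈ u , (λ n′ → Empty-elim (truth⁻ B B∈ u n′ b)) ]′
      (realised⁻ C C∈ u (⊑-false Σ {u = ty u} {ty w} u≤w C∈ n))
  truth⁻ C@(A ∨ B) C∈ w n e =
    let A∈ , B∈ = binary Σ closed C C∈ refl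
        n₁ , n₂ = realised⁻ C C∈ w n in
    e (truth⁻ A A∈ w n₁ , truth⁻ B B∈ w n₂)
  truth⁻ C@(A ∧ B) C∈ w n (a , b) =
    let A∈ , B∈ = binary Σ closed C C∈ refl in
    [ (λ n → truth⁻ A A∈ w n a) , (λ n → truth⁻ B B∈ w n b) ]′ (realised⁻ C C∈ w n)
  truth⁻ ⊤         C∈ w n _ = realised⁻ ⊤ C∈ w n
  truth⁻ ⊥         C∈ w n ()
  truth⁻ C@(◇ A)   C∈ w n e =
    let A∈ = unary Σ closed C C∈ refl in
    e λ {u} {v} u≤w (_ , _ , c) →
      truth⁻ A A∈ v (c A (∈-preimage⁺ Σ (ty u) A∈ C∈ (⊑-false Σ {u = ty u} {ty w} u≤w C∈ n)))
  truth⁻ C@(□ A)   C∈ w n f =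
    let A∈ = unary Σ closed C C∈ refl
        u , u∈ , w⊑u , v , v∈ , c , n′ = realised⁻ C C∈ w n
        v′ = unrestricted v v∈ in
    truth⁻ A A∈ v′ n′ (f {unrestricted u u∈} {v′} w⊑u (v∈ , c))
  truth⁻ C@(⧫ A)   C∈ w n f =
    let A∈ = unary Σ closed C C∈ refl
        u , u∈ , w⊑u , g = realised⁻ C C∈ w n in
    f {restricted false A u u∈ g} w⊑u λ {v} (v∈ , _) →
      truth⁻ A A∈ v (proj₂ (∈-filter⁻ (λ u → u A ≟ᵇ false) {xs = S} v∈))
  truth⁻ C@(■ A)   C∈ w n e =
    let A∈ = unary Σ closed C C∈ refl in
    e λ {u} u≤w f →
      let v , v∈ , c , n′ = proj₂ (good u) A (∈-preimage⁺ Σ (ty u) A∈ C∈ (⊑-false Σ {u = ty u} {ty w} u≤w C∈ n))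
          v′ = unrestricted v (included u v v∈) in
      truth⁻ A A∈ v′ n′ (f {v′} (v∈ , c))

  sound : ∀ {s} → s ∈ Lmin → Holds V s
  sound d = Lmin-least Valid-isIML d V-isValuation

  refuted⁺ : ∀ {A} → A ∈ˡ Σ → Some S (λ u → u A ≡ false) → ¬ (+ , A) ∈ Lmin
  refuted⁺ {A} A∈ (u , u∈ , n) d = truth⁻ A A∈ w n (sound d w)
    where w = unrestricted u u∈

  refuted⁻ : ∀ {A} → A ∈ˡ Σ → Some S (λ u → u A ≡ true) → ¬ (- , A) ∈ Lmin
  refuted⁻ {A} A∈ (u , u∈ , p) d = sound d w (truth⁺ A A∈ w p)
    where w = unrestricted u u∈

-- The decision procedure

derivable⁺ : ∀ {Σ S A} → Setting.Covering (setting Σ S) → A ∈ˡ Σ →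
             Every S (λ u → u A ≡ true) → (+ , A) ∈ Lmin
-- `covering` is used with `𝟙` on the left: all survivors accept `A`, so `𝟙 ≤ A`.
derivable⁺ covering A∈ f = mp ax-𝟙 (covering λ u∈ _ ≤Y below _ → ≤-trans (below A∈ (f _ u∈)) ≤Y)
  where open LogicProperties Lmin-logic

derivable⁻ : ∀ {Σ S A} → Setting.Covering (setting Σ S) → A ∈ˡ Σ →
             Every S (λ u → u A ≡ false) → (- , A) ∈ Lmin
-- Dually `A ≤ 𝟘`, which `⊢⇒⊣` turns into a negative derivation of `A` from `𝟘`.
derivable⁻ covering A∈ f = N.mp N.ax-𝟙 (⊢⇒⊣ (covering λ u∈ X≤ _ _ above → ≤-trans X≤ (above A∈ (f _ u∈))))
  where
  open LogicProperties Lmin-logic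
  module N = Calculus negative

proposition76 : Decidable Lmin
proposition76 (α , A)
  with eliminate Σ (λ _ → subformulas-trans A) (types Σ) (<-wellFounded _) (types-covering Σ)
    where Σ = subformulas A
... | S , covering , realised = decide α
  where
  open Countermodel (subformulas A) (λ _ → subformulas-trans A) S realised
  decide : ∀ α → Dec ((α , A) ∈ Lmin)
  decide + with some⊎every S (λ u → swap (true⊎false (u A)))
  ... | inj₁ refuting = no (refuted⁺ (here refl) refuting)
  ... | inj₂ verified = yes (derivable⁺ covering (here refl) verified)
  decide - with some⊎every S (λ u → true⊎false (u A))
  ... | inj₁ refuting = no (refuted⁻ (here refl) refuting)
  ... | inj₂ verified = yes (derivable⁻ covering (here refl) verified)
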